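{- In the 1-sided False Negative regime, given a moldgraph with $m$ edges and $n$ vertices, there exists an algorithm that finds a realized spanning tree using $O(m\log n)$ queries in expectation. If the moldgraph is $\rho$-sparse and minor-closed, the algorithm uses $O(\rho m)$ queries in expectation.
   Context: Problem (graph connectivity with noisy queries): a graph $G=(V,E)$, the moldgraph, with $n$ vertices and $m$ edges is given. An adversary selects an arbitrary connected spanning subgraph of $G$ to be realized. The algorithm may query an oracle on any edge $e$ (``Is $e$ realized?'') and receives ``Yes''/``No''; each query costs $1$, and answers to distinct queries (including repeated queries of the same edge) are independent. Goal: output a spanning tree of $G$ all of whose edges are realized. In the 1-sided False Negative regime: for a non-realized edge the answer is always ``No''; for a realized edge the answer is ``No'' with a constant probability $p<1/2$ and ``Yes'' with probability $1-p$ (so a ``Yes'' answer certifies the edge is realized). A graph with $m$ edges and $n$ vertices is $\rho$-sparse if $m\le\rho n$. A graph $H$ is a minor of $G$ if $H$ can be obtained from $G$ by edge deletions, vertex deletions and edge contractions; a family of graphs is minor-closed if it contains all minors of its members. ``The moldgraph is $\rho$-sparse and minor-closed'' means that it belongs to a minor-closed family of graphs all of whose members are $\rho$-sparse. -}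

module Defs where

open import Algebra.Bundles using (CommutativeRing)
import Algebra.Definitions.RawMonoid as RawMonoidOps
open import Data.Bool.Base using (Bool; true; false)
open import Data.Fin.Base using (Fin)
open import Data.Fin.Subset using (Subset; _∈_; _⊆_)
open import Data.List.Base using (List; []; _∷_; length)
open import Data.List.Relation.Unary.Unique.Propositional using (Unique)
open import Data.Nat.Base as ℕ using (ℕ; zero; suc)
open import Data.Nat.Logarithm using (⌊log₂_⌋)
open import Data.Product.Base using (_×_; _,_; ∃; ∃-syntax)
open import Data.Sum.Base using (_⊎_)
open import Data.Vec.Base using (lookup)
open import Function.Base using (_∘_)
open import Function.Bundles using (_⇔_)
open import Function.Definitions using (Injective; Surjective; Bijective)
open import Level using (Level; _⊔_) renaming (suc to lsuc)
open import Relation.Binary.Construct.Closure.ReflexiveTransitive using (Star)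
open import Relation.Binary.Core using (Rel)
open import Relation.Binary.Definitions using (Cotransitive)
open import Relation.Binary.PropositionalEquality.Core using (_≡_; _≢_)
open import Relation.Binary.Structures using (IsPartialOrder; IsStrictPartialOrder)
open import Relation.Nullary.Negation.Core using (¬_)
open import Relation.Unary using (Pred)

-- The library has no real numbers.  Up to isomorphism the Archimedean
-- ordered fields are exactly the subfields of ℝ (ℝ included), so a claim
-- about real parameters is stated for all of them.  The axioms neither assume
-- a decidable order nor a total one, so that constructive reals satisfy them.

record ArchimedeanOrderedField c ℓ₁ ℓ₂ ℓ₃ : Set (lsuc (c ⊔ ℓ₁ ⊔ ℓ₂ ⊔ ℓ₃)) where
  field
    commutativeRing : CommutativeRing c ℓ₁

  open CommutativeRing commutativeRing public

  infix 4 _≤_ _<_ _#_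

  field
    _≤_ : Rel Carrier ℓ₂
    _<_ : Rel Carrier ℓ₃

  _#_ : Rel Carrier ℓ₃
  x # y = x < y ⊎ y < x

  fromℕ : ℕ → Carrier
  fromℕ n = RawMonoidOps._×_ +-rawMonoid n 1#

  field
    ≤-isPartialOrder       : IsPartialOrder _≈_ _≤_
    <-isStrictPartialOrder : IsStrictPartialOrder _≈_ _<_
    <-cotrans              : Cotransitive _<_
    ≤⇔≯                    : ∀ {x y} → x ≤ y ⇔ (¬ (y < x))
    0<1                    : 0# < 1#
    +-monoˡ-≤              : ∀ z {x y} → x ≤ y → x + z ≤ y + z
    +-monoˡ-<              : ∀ z {x y} → x < y → x + z < y + z
    *-nonNegative          : ∀ {x y} → 0# ≤ x → 0# ≤ y → 0# ≤ x * y
    *-positive             : ∀ {x y} → 0# < x → 0# < y → 0# < x * y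
    #0⇔invertible          : ∀ {x} → x # 0# ⇔ (∃[ y ] x * y ≈ 1#)
    archimedean            : ∀ x → ∃[ n ] x < fromℕ n

-- Finite simple graphs on the vertex set Fin ∣V∣ with edges indexed by Fin ∣E∣.
-- The assignment of the two ends of an edge to src and tgt is immaterial.

record Graph : Set where
  field
    ∣V∣ : ℕ
    ∣E∣ : ℕ

  Vertex : Set
  Vertex = Fin ∣V∣

  Edge : Set
  Edge = Fin ∣E∣

  field
    src tgt : Edge → Vertex

  Joins : Edge → Vertex → Vertex → Set
  Joins e u v = (src e ≡ u × tgt e ≡ v) ⊎ (src e ≡ v × tgt e ≡ u)

  field
    loopless : ∀ e → src e ≢ tgt e
    simple   : ∀ {e f u v} → Joins e u v → Joins f u v → e ≡ f

  Adjacent : Rel Vertex _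
  Adjacent u v = ∃[ e ] Joins e u v

open Graph using (∣V∣; ∣E∣; Vertex; Edge; Joins; Adjacent)

-- A spanning subgraph of G is given by its set of edges.

SpanningSubgraph : Graph → Set
SpanningSubgraph G = Subset (∣E∣ G)

module _ (G : Graph) (S : SpanningSubgraph G) where

  data Walk : Rel (Vertex G) Level.zero where
    []   : ∀ {u} → Walk u u
    step : ∀ {u v w} e → e ∈ S → Joins G e u v → Walk v w → Walk u w

  edges : ∀ {u v} → Walk u v → List (Edge G)
  edges []             = []
  edges (step e _ _ w) = e ∷ edges w

  -- All vertices visited except the last one, so that on a closed walk the
  -- base point is listed once.
  vertices : ∀ {u v} → Walk u v → List (Vertex G)
  vertices []                 = []
  vertices (step {u} _ _ _ w) = u ∷ vertices w

  IsCycle : ∀ {u} → Walk u u → Set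
  IsCycle w = edges w ≢ [] × Unique (edges w) × Unique (vertices w)

  Connected : Set
  Connected = ∀ u v → Walk u v

  Acyclic : Set
  Acyclic = ∀ {u} (w : Walk u u) → ¬ IsCycle w

  IsSpanningTree : Set
  IsSpanningTree = Connected × Acyclic

-- H arises from G by one operation, up to renaming vertices and edges.  After
-- a contraction, loops are dropped and parallel edges are merged.

data _⟶_ (G H : Graph) : Set where

  deleteEdge :
    (e : Edge G) (φ : Vertex G → Vertex H) →
    Bijective _≡_ _≡_ φ →
    (∀ u v → Adjacent H (φ u) (φ v) ⇔ (∃[ f ] f ≢ e × Joins G f u v)) →
    G ⟶ H

  deleteVertex :
    (v : Vertex G) (φ : Vertex H → Vertex G) →
    Injective _≡_ _≡_ φ →
    (∀ u → (∃[ x ] φ x ≡ u) ⇔ u ≢ v) →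
    (∀ x y → Adjacent H x y ⇔ Adjacent G (φ x) (φ y)) →
    G ⟶ H

  contractEdge :
    (e : Edge G) (φ : Vertex G → Vertex H) →
    Surjective _≡_ _≡_ φ →
    (∀ u v → φ u ≡ φ v ⇔ (u ≡ v ⊎ Joins G e u v)) →
    (∀ x y → Adjacent H x y ⇔
      (x ≢ y × (∃[ u ] ∃[ v ] φ u ≡ x × φ v ≡ y × Adjacent G u v))) →
    G ⟶ H

_HasMinor_ : Rel Graph _
_HasMinor_ = Star _⟶_

MinorClosed : ∀ {ℓ} → Pred Graph ℓ → Set ℓ
MinorClosed 𝓕 = ∀ {G H} → G HasMinor H → 𝓕 G → 𝓕 H

-- An adaptive algorithm on a known moldgraph: from the answers received so far
-- (latest first) it decides whether to query another edge or to stop.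

data Answer : Set where
  Yes No : Answer

data Action (G : Graph) : Set where
  query  : Edge G → Action G
  output : SpanningSubgraph G → Action G

History : Graph → Set
History G = List (Edge G × Answer)

Algorithm : Graph → Set
Algorithm G = History G → Action G

module OneSidedFalseNegative
  {c ℓ₁ ℓ₂ ℓ₃} (K : ArchimedeanOrderedField c ℓ₁ ℓ₂ ℓ₃)
  (p : ArchimedeanOrderedField.Carrier K)
  where

  open ArchimedeanOrderedField K

  IsErrorProbability : Set (ℓ₂ ⊔ ℓ₃)
  IsErrorProbability = 0# ≤ p × fromℕ 2 * p < 1#

  Sparse : Carrier → Graph → Set ℓ₂
  Sparse ρ G = fromℕ (∣E∣ G) ≤ ρ * fromℕ (∣V∣ G)

  answerProb : (realized : Bool) → Answer → Carrier
  answerProb true  Yes = 1# - p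
  answerProb true  No  = p
  answerProb false Yes = 0#
  answerProb false No  = 1#

  module _ {G : Graph} (R : SpanningSubgraph G) where

    Pr : Edge G → Answer → Carrier
    Pr e a = answerProb (lookup R e) a

    module _ (A : Algorithm G) where

      -- Histories that occur with nonzero probability.
      data Occurs : History G → Set ℓ₁ where
        start : Occurs []
        next  : ∀ {h e a} → Occurs h → A h ≡ query e → Pr e a ≉ 0# →
                Occurs ((e , a) ∷ h)

      FindsRealizedSpanningTree : Set ℓ₁
      FindsRealizedSpanningTree = ∀ {h T} → Occurs h → A h ≡ output T →
        IsSpanningTree G T × T ⊆ R

      -- 𝔼 N f h is the expected value of f at the history reached from h
      -- after N further queries, or on stopping if that happens earlier.
      𝔼 : ℕ → (History G → Carrier) → History G → Carrier
      𝔼 zero    f h = f h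
      𝔼 (suc N) f h with A h
      ... | output _ = f h
      ... | query e  = Pr e Yes * 𝔼 N f ((e , Yes) ∷ h)
                     + Pr e No  * 𝔼 N f ((e , No)  ∷ h)

      -- For the total number Q of queries, E[Q] is the supremum over N of
      -- E[min(Q, N)], which is the expression below.  Since
      -- N · P(Q ≥ N) ≤ E[min(Q, N)], a bound also makes Q finite almost surely.
      ExpectedQueries≤ : Carrier → Set ℓ₂
      ExpectedQueries≤ B = ∀ N → 𝔼 N (fromℕ ∘ length) [] ≤ B

  -- The two query bounds.  As ⌊log₂ n⌋ ≤ log₂ n, rounding down only
  -- sharpens the first; when it vanishes, n ≤ 1 and there are no edges.

  Uses-O[m*logn] : ℕ → ∀ {G} → SpanningSubgraph G → Algorithm G → Set ℓ₂
  Uses-O[m*logn] C {G} R A =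
    ExpectedQueries≤ R A (fromℕ (C ℕ.* (∣E∣ G ℕ.* ⌊log₂ ∣V∣ G ⌋)))

  Uses-O[ρ*m] : ℕ → Carrier → ∀ {G} → SpanningSubgraph G → Algorithm G → Set ℓ₂
  Uses-O[ρ*m] C ρ {G} R A =
    ExpectedQueries≤ R A (fromℕ C * (ρ * fromℕ (∣E∣ G)))

  -- 𝓕 witnesses that the moldgraph G is "ρ-sparse and minor-closed".
  SparseMinorClosed : ∀ {ℓ} → Carrier → Pred Graph ℓ → Graph → Set (ℓ₂ ⊔ ℓ)
  SparseMinorClosed ρ 𝓕 G = MinorClosed 𝓕 × (∀ {H} → 𝓕 H → Sparse ρ H) × 𝓕 G

{-# OPTIONS --safe #-}

-- Borůvka's scheme: grow a forest of realized edges, and from the contracted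
-- graph pick a component x whose number of neighbours and number of leaving
-- edges are both at most twice their averages over the k components.  Group
-- the edges leaving x by neighbour, the smallest groups first, and query the
-- first 1, 2, 4, … edges of this list until the answer is Yes.  If the first
-- realized edge has position a, a pass that reaches it fails with probability
-- at most p, and as 2p < 1 the expected number of queries until Yes is O(a).
--
-- On the one hand a is at most the number of edges leaving x, which is at most
-- 4m/k; summing over k gives O(m log n).  On the other hand a is at most the
-- number of neighbours of x times the size of the group of any realized edge,
-- in particular of the edge found, and that group disappears by contracting it.
-- In a ρ-sparse minor-closed family the number of neighbours is at most 4ρ, so
-- the total is O(ρ m).
module Submission where

open import Defs
open import Algebra.Properties.Monoid.Mult using (×-homo-+)
open import Algebra.Properties.Semiring.Mult using (×1-homo-*)
import Algebra.Solver.Ring.NaturalCoefficients.Default as NaturalCoefficients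
open import Data.Bool.Base using (Bool; true; false; if_then_else_; _∨_)
open import Data.Fin.Base as Fin using (Fin; zero; suc; punchIn; punchOut)
open import Data.Fin.Properties as Fin
  using (_≟_; any?; punchInᵢ≢i; punchOut-cong; punchOut-injective; punchOut-punchIn)
open import Data.Fin.Subset as Subset using (Subset; _∪_; ⁅_⁆)
open import Data.Fin.Subset.Properties using (x∈p∪q⁻; x∈p∪q⁺; p⊆p∪q; x∈⁅x⁆; x∈⁅y⁆⇒x≡y; ∉⊥)
open import Data.List.Base as List
  using (List; []; _∷_; _++_; length; map; filter; concatMap; allFin; take; cartesianProduct)
import Data.List.Extrema as Extrema
import Data.List.Membership.DecPropositional as DecMembership
open import Data.List.Membership.Propositional using (_∈_; _∉_)
open import Data.List.Membership.Propositional.Properties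
  using (∈-allFin; ∈-filter⁺; ∈-filter⁻; ∈-concatMap⁺; ∈-concatMap⁻; ∈-lookup; ∈-cartesianProduct⁺)
open import Data.List.Properties using (length-++; length-take)
open import Data.List.Relation.Binary.Permutation.Propositional using (↭-sym)
open import Data.List.Relation.Binary.Permutation.Propositional.Properties as ↭
  using (∈-resp-↭; ↭-length)
open import Data.List.Relation.Binary.Subset.Propositional using (_⊆_)
open import Data.List.Relation.Unary.All as All using (All)
open import Data.List.Relation.Unary.AllPairs using (AllPairs; []; _∷_)
open import Data.List.Relation.Unary.Any as Any using (here; there)
open import Data.List.Relation.Unary.Any.Properties using (lookup-index)
open import Data.List.Relation.Unary.Linked.Properties using (Linked⇒AllPairs)
open import Data.List.Relation.Unary.Unique.Propositional using (Unique)
import Data.List.Relation.Unary.Unique.Propositional.Properties as Unique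
import Data.List.Sort as Sort
open import Data.Nat.Base as ℕ using (ℕ; zero; suc; z≤n; s≤s; pred; NonZero; >-nonZero; s≤s⁻¹; ≤′-refl; ≤′-step)
open import Data.Nat.DivMod
  using (_/_; _%_; n/1≡n; m*n/n≡m; /-monoˡ-≤; /-monoʳ-≤; m/n/o≡m/[n*o]; m/n*n≤m; m≡m%n+[m/n]*n; m%n<n)
open import Data.Nat.Induction using (<-rec)
open import Data.Nat.ListAction using (sum)
open import Data.Nat.ListAction.Properties using (sum-↭)
open import Data.Nat.Logarithm using (⌊log₂_⌋; ⌊log₂⌋-mono-≤; ⌊log₂[2*b]⌋≡1+⌊log₂b⌋)
import Data.Nat.Properties as Nat
open import Data.Nat.Solver using () renaming (module +-*-Solver to Nat-Solver)
open import Data.Product.Base using (_×_; _,_; proj₁; proj₂; ∃-syntax; Σ-syntax; uncurry)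
open import Data.Sum.Base using (_⊎_; inj₁; inj₂)
open import Data.Vec.Base as Vec using ()
open import Data.Vec.Functional using (Vector)
open import Data.Vec.Properties using (lookup⇒[]=; []=⇒lookup)
open import Function.Base using (_∘_; id)
open import Function.Bundles using (_⇔_; mk⇔; Equivalence)
open import Relation.Binary.Bundles using (Poset)
open import Relation.Binary.Construct.Closure.ReflexiveTransitive using (ε; _◅_)
import Relation.Binary.Construct.On as On
open import Relation.Binary.Definitions using (tri<; tri≈; tri>)
open import Relation.Binary.PropositionalEquality as ≡ using (_≡_; _≢_; refl; subst)
import Relation.Binary.Reasoning.PartialOrder as PartialOrderReasoning
open import Relation.Binary.Structures using (IsPartialOrder; IsStrictPartialOrder)
open import Relation.Nullary
open import Relation.Unary using (Pred; Decidable)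
open import Algebra.Properties.CommutativeMonoid.Sum Nat.+-0-commutativeMonoid
  using (∑-comm; ∑-distrib-+; sum-cong-≗) renaming (sum to ∑)
open Graph using (∣V∣; ∣E∣; Vertex; Edge; src; tgt; Joins; Adjacent)

module _ where
  open import Data.Nat.Base using (_+_; _*_; _≤_; _<_; _≤′_)
  open import Data.Nat.Properties hiding (_≟_)
  open import Relation.Binary.PropositionalEquality using (sym; trans; cong; cong₂; subst₂; module ≡-Reasoning)
  open Extrema ≤-totalOrder using (argmin; f[argmin]≤f[xs])

  -- Indicators and finite sums of natural numbers.

  𝟙 : ∀ {ℓ} {P : Set ℓ} → Dec P → ℕ
  𝟙 P? = if does P? then 1 else 0

  𝟙-mono : ∀ {a b} {P : Set a} {Q : Set b} (P? : Dec P) (Q? : Dec Q) → (P → Q) → 𝟙 P? ≤ 𝟙 Q?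
  𝟙-mono (no _)  _        f = z≤n
  𝟙-mono (yes _) (yes _)  f = ≤-refl
  𝟙-mono (yes p) (no ¬q)  f = contradiction (f p) ¬q

  𝟙≤1 : ∀ {a} {P : Set a} (P? : Dec P) → 𝟙 P? ≤ 1
  𝟙≤1 (yes _) = ≤-refl
  𝟙≤1 (no _)  = z≤n

  ∑-mono : ∀ {n} {f g : Vector ℕ n} → (∀ i → f i ≤ g i) → ∑ f ≤ ∑ g
  ∑-mono {zero}  f≤g = z≤n
  ∑-mono {suc n} f≤g = +-mono-≤ (f≤g zero) (∑-mono (f≤g ∘ suc))

  ∑-const : ∀ n c → ∑ {n} (λ _ → c) ≡ n * c
  ∑-const zero    c = refl
  ∑-const (suc n) c = cong (c +_) (∑-const n c)

  term≤∑ : ∀ {n} (f : Vector ℕ n) i → f i ≤ ∑ f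
  term≤∑ f zero    = m≤m+n _ _
  term≤∑ f (suc i) = ≤-trans (term≤∑ (f ∘ suc) i) (m≤n+m _ _)

  ∑-*ʳ : ∀ {n} (f : Vector ℕ n) c → ∑ (λ i → f i * c) ≡ ∑ f * c
  ∑-*ʳ {zero}  f c = refl
  ∑-*ʳ {suc n} f c = trans (cong (f zero * c +_) (∑-*ʳ (f ∘ suc) c))
                           (sym (*-distribʳ-+ c (f zero) _))

  ∑-𝟙≟ : ∀ {n} (j : Fin n) → ∑ (λ i → 𝟙 (j ≟ i)) ≡ 1
  ∑-𝟙≟ {suc n} zero    = cong suc (trans (∑-const n 0) (*-zeroʳ n))
  ∑-𝟙≟ {suc n} (suc j) = trans (sum-cong-≗ (λ i → suc≟ i)) (∑-𝟙≟ j)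
    where
    suc≟ : ∀ i → 𝟙 (suc j ≟ suc i) ≡ 𝟙 (j ≟ i)
    suc≟ i = refl

  length-filter : ∀ {ℓ a n} {A : Set a} {P : Pred A ℓ} (P? : Decidable P) (g : Fin n → A) →
                  length (filter P? (List.tabulate g)) ≡ ∑ (λ i → 𝟙 (P? (g i)))
  length-filter {n = zero}  P? g = refl
  length-filter {n = suc n} P? g with P? (g zero)
  ... | yes _ = cong suc (length-filter P? (g ∘ suc))
  ... | no  _ = length-filter P? (g ∘ suc)

  sum-filter-≤ : ∀ {ℓ a n} {A : Set a} {P : Pred A ℓ} (P? : Decidable P) (f : A → ℕ) (g : Fin n → A) →
                 sum (map f (filter P? (List.tabulate g))) ≤ ∑ (f ∘ g)
  sum-filter-≤ {n = zero}  P? f g = z≤n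
  sum-filter-≤ {n = suc n} P? f g with P? (g zero)
  ... | yes _ = +-monoʳ-≤ (f (g zero)) (sum-filter-≤ P? f (g ∘ suc))
  ... | no  _ = ≤-trans (sum-filter-≤ P? f (g ∘ suc)) (m≤n+m _ _)

  length-concatMap : ∀ {a b} {A : Set a} {B : Set b} (f : A → List B) xs →
                     length (concatMap f xs) ≡ sum (map (length ∘ f) xs)
  length-concatMap f []       = refl
  length-concatMap f (x ∷ xs) = trans (length-++ (f x)) (cong (length (f x) +_) (length-concatMap f xs))

  abstract
    argminFin : ∀ {n} → (Fin (suc n) → ℕ) → Fin (suc n)
    argminFin {n} f = argmin f zero (allFin (suc n))

    argminFin-≤ : ∀ {n} (f : Fin (suc n) → ℕ) i → f (argminFin f) ≤ f i
    argminFin-≤ {n} f i = All.lookup (f[argmin]≤f[xs] {f = f} zero (allFin (suc n))) (∈-allFin i)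

  -- A minimum is at most the mean, multiplied out to stay in the naturals.
  argminFin-average : ∀ {n} (f : Fin (suc n) → ℕ) → suc n * f (argminFin f) ≤ ∑ f
  argminFin-average {n} f = subst (_≤ ∑ f) (∑-const (suc n) _) (∑-mono (argminFin-≤ f))

  -- The position of the first realized edge in a list.

  module _ {m} (R : Subset m) where

    -- Positions count from 1, so the value is the number of edges up to and including the first
    -- realized one. Without such an edge it is the length.
    firstHit : List (Fin m) → ℕ
    firstHit []       = 0
    firstHit (e ∷ es) = if Vec.lookup R e then 1 else suc (firstHit es)

    firstHit≤length : ∀ es → firstHit es ≤ length es
    firstHit≤length []       = z≤n
    firstHit≤length (e ∷ es) with Vec.lookup R e
    ... | true  = s≤s z≤n
    ... | false = s≤s (firstHit≤length es)

    firstHit-++ : ∀ es fs → firstHit (es ++ fs) ≤ length es + firstHit fs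
    firstHit-++ []       fs = ≤-refl
    firstHit-++ (e ∷ es) fs with Vec.lookup R e
    ... | true  = s≤s z≤n
    ... | false = s≤s (firstHit-++ es fs)

    firstHit-++-hit : ∀ {e es} fs → e ∈ es → Vec.lookup R e ≡ true → firstHit (es ++ fs) ≤ length es
    firstHit-++-hit fs (here refl) hit rewrite hit = s≤s z≤n
    firstHit-++-hit {es = e ∷ es} fs (there e∈) hit with Vec.lookup R e
    ... | true  = s≤s z≤n
    ... | false = s≤s (firstHit-++-hit fs e∈ hit)

    -- The first hit comes no later than the end of the group `f x`, and no group up to there is
    -- longer than `f x`, as the lengths ascend.
    firstHit-concatMap : ∀ {a} {A : Set a} (f : A → List (Fin m)) {x xs e} →
                         AllPairs (λ y z → length (f y) ≤ length (f z)) xs →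
                         x ∈ xs → e ∈ f x → Vec.lookup R e ≡ true →
                         firstHit (concatMap f xs) ≤ length xs * length (f x)
    firstHit-concatMap f {xs = y ∷ ys} _ (here refl) e∈ hit =
      ≤-trans (firstHit-++-hit (concatMap f ys) e∈ hit) (m≤m+n _ _)
    firstHit-concatMap f {xs = y ∷ ys} (y≤ ∷ sorted) (there x∈) e∈ hit =
      ≤-trans (firstHit-++ (f y) (concatMap f ys))
              (+-mono-≤ (All.lookup y≤ x∈) (firstHit-concatMap f sorted x∈ e∈ hit))

  -- Multigraphs: bundles, neighbours and leaving edges.

  -- Parallel edges of a contracted graph are kept: edge e joins s e and t e.
  module Multigraph {k m} (s t : Fin m → Fin k) where

    Between : Fin m → Fin k → Fin k → Set
    Between e x y = (s e ≡ x × t e ≡ y) ⊎ (s e ≡ y × t e ≡ x)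

    between? : ∀ e x y → Dec (Between e x y)
    between? e x y = ((s e ≟ x) ×-dec (t e ≟ y)) ⊎-dec ((s e ≟ y) ×-dec (t e ≟ x))

    -- Summing over the edges last, each edge contributes at most two ordered pairs, one per
    -- orientation.
    ∑-between : ∑ (λ x → ∑ (λ y → ∑ (λ e → 𝟙 (between? e x y)))) ≤ 2 * m
    ∑-between = begin
      ∑ (λ x → ∑ (λ y → ∑ (λ e → 𝟙 (between? e x y))))
        ≡⟨ sum-cong-≗ (λ x → ∑-comm (λ y e → 𝟙 (between? e x y))) ⟩
      ∑ (λ x → ∑ (λ e → ∑ (λ y → 𝟙 (between? e x y))))
        ≡⟨ ∑-comm (λ x e → ∑ (λ y → 𝟙 (between? e x y))) ⟩
      ∑ (λ e → ∑ (λ x → ∑ (λ y → 𝟙 (between? e x y))))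
        ≤⟨ ∑-mono (λ e → ∑-mono (λ x → ∑-mono (λ y → split e x y))) ⟩
      ∑ (λ e → ∑ (λ x → ∑ (λ y → 𝟙 (t e ≟ y) * 𝟙 (s e ≟ x) + 𝟙 (s e ≟ y) * 𝟙 (t e ≟ x))))
        ≡⟨ sum-cong-≗ two ⟩
      ∑ {m} (λ e → 2)
        ≡⟨ ∑-const m 2 ⟩
      m * 2
        ≡⟨ *-comm m 2 ⟩
      2 * m ∎
      where
      open ≤-Reasoning
      -- The factor in `y` comes first in each product, so that the factor in `x` can be pulled out
      -- of the inner sum.
      split : ∀ e x y → 𝟙 (between? e x y) ≤ 𝟙 (t e ≟ y) * 𝟙 (s e ≟ x) + 𝟙 (s e ≟ y) * 𝟙 (t e ≟ x)
      split e x y with s e ≟ x | t e ≟ y | s e ≟ y | t e ≟ x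
      ... | yes _ | yes _ | _     | _     = s≤s z≤n
      ... | yes _ | no _  | yes _ | yes _ = s≤s z≤n
      ... | yes _ | no _  | yes _ | no _  = z≤n
      ... | yes _ | no _  | no _  | _     = z≤n
      ... | no _  | yes _ | yes _ | yes _ = s≤s z≤n
      ... | no _  | yes _ | yes _ | no _  = z≤n
      ... | no _  | yes _ | no _  | _     = z≤n
      ... | no _  | no _  | yes _ | yes _ = s≤s z≤n
      ... | no _  | no _  | yes _ | no _  = z≤n
      ... | no _  | no _  | no _  | _     = z≤n
      inner : ∀ e x → ∑ (λ y → 𝟙 (t e ≟ y) * 𝟙 (s e ≟ x) + 𝟙 (s e ≟ y) * 𝟙 (t e ≟ x))
                    ≡ 𝟙 (s e ≟ x) + 𝟙 (t e ≟ x)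
      inner e x = trans
        (∑-distrib-+ (λ y → 𝟙 (t e ≟ y) * 𝟙 (s e ≟ x)) (λ y → 𝟙 (s e ≟ y) * 𝟙 (t e ≟ x)))
        (cong₂ _+_ (once (t e) _) (once (s e) _))
        where
        once : ∀ j c → ∑ (λ y → 𝟙 (j ≟ y) * c) ≡ c
        once j c = trans (∑-*ʳ (λ y → 𝟙 (j ≟ y)) c) (trans (cong (_* c) (∑-𝟙≟ j)) (+-identityʳ c))
      two : ∀ e → ∑ (λ x → ∑ (λ y → 𝟙 (t e ≟ y) * 𝟙 (s e ≟ x) + 𝟙 (s e ≟ y) * 𝟙 (t e ≟ x))) ≡ 2
      two e = trans (sum-cong-≗ (inner e))
        (trans (∑-distrib-+ (λ x → 𝟙 (s e ≟ x)) (λ x → 𝟙 (t e ≟ x)))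
               (cong₂ _+_ (∑-𝟙≟ (s e)) (∑-𝟙≟ (t e))))

    Linked : Fin k → Fin k → Set
    Linked x y = x ≢ y × ∃[ e ] Between e x y

    linked? : ∀ x y → Dec (Linked x y)
    linked? x y = ¬? (x ≟ y) ×-dec any? (λ e → between? e x y)

    bundle : Fin k → Fin k → List (Fin m)
    bundle x y = filter (λ e → between? e x y) (allFin m)

    width : Fin k → Fin k → ℕ
    width x y = length (bundle x y)

    neighbours : Fin k → List (Fin k)
    neighbours x = filter (linked? x) (allFin k)

    module ByWidth (x : Fin k) = Sort (On.decTotalOrder ≤-decTotalOrder (width x))

    abstract
      sortedNeighbours : Fin k → List (Fin k)
      sortedNeighbours x = ByWidth.sort x (neighbours x)

      leaving : Fin k → List (Fin m)
      leaving x = concatMap (bundle x) (sortedNeighbours x)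

      degree : Fin k → ℕ
      degree x = length (neighbours x)

    load : Fin k → ℕ
    load x = length (leaving x)

    abstract
      ∈-bundle⁻ : ∀ {e x y} → e ∈ bundle x y → Between e x y
      ∈-bundle⁻ {x = x} {y} = proj₂ ∘ ∈-filter⁻ (λ e → between? e x y) {xs = allFin m}

      ∈-bundle⁺ : ∀ {e x y} → Between e x y → e ∈ bundle x y
      ∈-bundle⁺ {e} {x} {y} = ∈-filter⁺ (λ e → between? e x y) (∈-allFin e)

      ∈-leaving⁻ : ∀ {e} x → e ∈ leaving x → ∃[ y ] y ∈ sortedNeighbours x × x ≢ y × Between e x y
      ∈-leaving⁻ {e} x e∈ = go (∈-concatMap⁻ (bundle x) {xs = sortedNeighbours x} e∈) id
        where
        -- The recursion runs over suffixes of the sorted list, so their inclusion in the whole list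
        -- is carried along.
        go : ∀ {ys} → Any.Any (λ y → e ∈ bundle x y) ys → (∀ {y} → y ∈ ys → y ∈ sortedNeighbours x) →
             ∃[ y ] y ∈ sortedNeighbours x × x ≢ y × Between e x y
        go (here {y} e∈b) ⊆ = y , ⊆ (here refl) , x≢y , ∈-bundle⁻ e∈b
          where
          x≢y : x ≢ y
          x≢y = proj₁ (proj₂ (∈-filter⁻ (linked? x) {xs = allFin k}
                         (∈-resp-↭ (ByWidth.sort-↭ x _) (⊆ (here refl)))))
        go (there any′) ⊆ = go any′ (⊆ ∘ there)

      ∈-leaving⁺ : ∀ {e x y} → x ≢ y → Between e x y → e ∈ leaving x
      ∈-leaving⁺ {e} {x} {y} x≢y b = ∈-concatMap⁺ (bundle x)
        (Any.map (λ { refl → ∈-bundle⁺ b })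
          (∈-resp-↭ (↭-sym (ByWidth.sort-↭ x _))
            (∈-filter⁺ (linked? x) (∈-allFin y) (x≢y , e , b))))

      length-sortedNeighbours : ∀ x → length (sortedNeighbours x) ≡ degree x
      length-sortedNeighbours x = ↭-length (ByWidth.sort-↭ x _)

      sortedNeighbours-↗ : ∀ x → AllPairs (λ y z → width x y ≤ width x z) (sortedNeighbours x)
      sortedNeighbours-↗ x = Linked⇒AllPairs ≤-trans (ByWidth.sort-↗ x _)

      -- A load is a sum of widths over the neighbours; extending it to all vertices gives the
      -- double count of `∑-between`.
      ∑-load≤ : ∑ load ≤ 2 * m
      ∑-load≤ = ≤-trans (∑-mono load≤) ∑-between
        where
        open ≤-Reasoning
        load≤ : ∀ x → load x ≤ ∑ (λ y → ∑ (λ e → 𝟙 (between? e x y)))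
        load≤ x = begin
          load x                                    ≡⟨ length-concatMap (bundle x) (sortedNeighbours x) ⟩
          sum (map (width x) (sortedNeighbours x))  ≡⟨ sum-↭ (↭.map⁺ (width x) (ByWidth.sort-↭ x _)) ⟩
          sum (map (width x) (neighbours x))        ≤⟨ sum-filter-≤ (linked? x) (width x) id ⟩
          ∑ (width x)
            ≡⟨ sum-cong-≗ (λ y → length-filter (λ e → between? e x y) id) ⟩
          ∑ (λ y → ∑ (λ e → 𝟙 (between? e x y)))    ∎

      -- The edge `e` may be any realized edge of the list, not only the first: the bundle that is
      -- charged has to be the one of the edge that gets contracted.
      firstHit-leaving : ∀ (R : Subset m) {e x y} → y ∈ sortedNeighbours x → Between e x y →
                         Vec.lookup R e ≡ true → firstHit R (leaving x) ≤ degree x * width x y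
      firstHit-leaving R {x = x} {y} y∈ b hit = ≤-trans
        (firstHit-concatMap R (bundle x) (sortedNeighbours-↗ x) y∈ (∈-bundle⁺ b) hit)
        (*-monoˡ-≤ (width x y) (≤-reflexive (length-sortedNeighbours x)))

      load>0⇒degree>0 : ∀ x → 0 < load x → 0 < degree x
      load>0⇒degree>0 x 0<load = subst (0 <_) (length-sortedNeighbours x) (nonEmpty (sortedNeighbours x) 0<load)
        where
        nonEmpty : ∀ ys → 0 < length (concatMap (bundle x) ys) → 0 < length ys
        nonEmpty (_ ∷ _) _ = s≤s z≤n

      degree≡∑ : ∀ x → degree x ≡ ∑ (λ y → 𝟙 (linked? x y))
      degree≡∑ x = length-filter (linked? x) id

  -- The hub: a vertex with few neighbours and few leaving edges.

  private
    -- The right-hand side of the hypothesis is `2 * D * L`; dropping the term `l * D` leaves a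
    -- common factor `L` to cancel.
    cancelˡ : ∀ k d l D L → 0 < L → k * (d * L + l * D) ≤ D * L + L * D → k * d ≤ 2 * D
    cancelˡ k d l D L 0<L average = *-cancelʳ-≤ (k * d) (2 * D) L {{>-nonZero 0<L}} (begin
      k * d * L              ≡⟨ *-assoc k d L ⟩
      k * (d * L)            ≤⟨ *-monoʳ-≤ k (m≤m+n (d * L) (l * D)) ⟩
      k * (d * L + l * D)    ≤⟨ average ⟩
      D * L + L * D          ≡⟨ solve 2 (λ D L → D :* L :+ L :* D := con 2 :* D :* L) refl D L ⟩
      2 * D * L              ∎)
      where
      open ≤-Reasoning
      open Nat-Solver

    cancelʳ : ∀ k d l D L → 0 < D → k * (d * L + l * D) ≤ D * L + L * D → k * l ≤ 2 * L
    cancelʳ k d l D L 0<D average = cancelˡ k l d L D 0<D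
      (subst₂ _≤_ (cong (k *_) (+-comm (d * L) (l * D))) (+-comm (D * L) (L * D)) average)

  module Hub {k m} (s t : Fin m → Fin (suc k)) where
    open Multigraph s t

    -- The sum of the fractions `degree x / ∑ degree` and `load x / ∑ load` with denominators
    -- cleared.
    relativeCost : Fin (suc k) → ℕ
    relativeCost x = degree x * ∑ load + load x * ∑ degree

    -- Minimising the sum of the two costs, each relative to its total, keeps
    -- both within twice their averages.
    hub : Fin (suc k)
    hub = argminFin relativeCost

    private
      average : suc k * relativeCost hub ≤ ∑ degree * ∑ load + ∑ load * ∑ degree
      average = ≤-trans (argminFin-average relativeCost) (≤-reflexive (trans
        (∑-distrib-+ (λ x → degree x * ∑ load) (λ x → load x * ∑ degree))
        (cong₂ _+_ (∑-*ʳ degree (∑ load)) (∑-*ʳ load (∑ degree)))))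

    -- A positive load at the hub makes the total load positive, and that total is the factor to be
    -- cancelled.
    degree-hub : 0 < load hub → suc k * degree hub ≤ 2 * ∑ degree
    degree-hub 0<load = cancelˡ (suc k) (degree hub) (load hub) (∑ degree) (∑ load)
      (<-≤-trans 0<load (term≤∑ load hub)) average

    load-hub : 0 < degree hub → suc k * load hub ≤ 2 * ∑ load
    load-hub 0<degree = cancelʳ (suc k) (degree hub) (load hub) (∑ degree) (∑ load)
      (<-≤-trans 0<degree (term≤∑ degree hub)) average

  module _ {k m m′} (s t : Fin m → Fin k) (s′ t′ : Fin m′ → Fin k) where
    private
      module M = Multigraph s t
      module N = Multigraph s′ t′

    -- Degrees count neighbours rather than edges, so any multigraph that joins all linked pairs can
    -- do the counting, in particular the simple graph behind a contraction.
    ∑-degree≤ : (∀ {x y} → M.Linked x y → ∃[ e ] N.Between e x y) → ∑ M.degree ≤ 2 * m′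
    ∑-degree≤ covered = ≤-trans (∑-mono degree≤) N.∑-between
      where
      linked≤ : ∀ {x y} (linked? : Dec (M.Linked x y)) → 𝟙 linked? ≤ ∑ (λ e → 𝟙 (N.between? e x y))
      linked≤ (no  _) = z≤n
      linked≤ {x} {y} (yes l) with covered l
      ... | e , b = ≤-trans (𝟙-mono (yes b) (N.between? e x y) id) (term≤∑ (λ e → 𝟙 (N.between? e x y)) e)
      degree≤ : ∀ x → M.degree x ≤ ∑ (λ y → ∑ (λ e → 𝟙 (N.between? e x y)))
      degree≤ x = ≤-trans (≤-reflexive (M.degree≡∑ x)) (∑-mono (λ y → linked≤ (M.linked? x y)))

  -- Merging two labels, and the simple graph under a multigraph.

  lookup-injective : ∀ {a} {A : Set a} {xs : List A} → Unique xs →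
                     ∀ i j → List.lookup xs i ≡ List.lookup xs j → i ≡ j
  lookup-injective (_ ∷ _)  zero    zero    _  = refl
  lookup-injective (x ∷ _)  zero    (suc j) eq = contradiction eq (All.lookup x (∈-lookup j))
  lookup-injective (x ∷ _)  (suc i) zero    eq = contradiction (sym eq) (All.lookup x (∈-lookup i))
  lookup-injective (_ ∷ xs) (suc i) (suc j) eq = cong suc (lookup-injective xs i j eq)

  -- The label `y` is given up in favour of `x`. Writing `pred k` keeps the type uniform; `x` itself
  -- shows that `k` is positive.
  merge : ∀ {k} {x y : Fin k} → x ≢ y → Fin k → Fin (pred k)
  merge {suc _} {x} {y} x≢y z with y ≟ z
  ... | yes _  = punchOut (x≢y ∘ sym)
  ... | no y≢z = punchOut y≢z

  merge-identifies : ∀ {k} {x y : Fin k} (x≢y : x ≢ y) → merge x≢y x ≡ merge x≢y y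
  merge-identifies {suc _} {x} {y} x≢y with y ≟ x | y ≟ y
  ... | _       | no y≢y = contradiction refl y≢y
  ... | yes y≡x | _      = contradiction (sym y≡x) x≢y
  ... | no _    | yes _  = punchOut-cong y refl

  merge-injective : ∀ {k} {x y : Fin k} (x≢y : x ≢ y) {u v} → merge x≢y u ≡ merge x≢y v →
                    u ≡ v ⊎ (x ≡ u × y ≡ v) ⊎ (x ≡ v × y ≡ u)
  merge-injective {suc _} {x} {y} x≢y {u} {v} eq with y ≟ u | y ≟ v
  ... | yes y≡u | yes y≡v = inj₁ (trans (sym y≡u) y≡v)
  ... | yes y≡u | no y≢v  = inj₂ (inj₂ (punchOut-injective _ y≢v eq , y≡u))
  ... | no y≢u  | yes y≡v = inj₂ (inj₁ (sym (punchOut-injective y≢u _ eq) , y≡v))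
  ... | no y≢u  | no y≢v  = inj₁ (punchOut-injective y≢u y≢v eq)

  merge-surjective : ∀ {k} {x y : Fin k} (x≢y : x ≢ y) z → ∃[ u ] merge x≢y u ≡ z
  merge-surjective {suc _} {x} {y} x≢y z = punchIn y z , eq
    where
    eq : merge x≢y (punchIn y z) ≡ z
    eq with y ≟ punchIn y z
    ... | yes y≡ = contradiction (sym y≡) (punchInᵢ≢i y z)
    ... | no _   = trans (punchOut-cong y refl) (punchOut-punchIn y)

  module _ {k m} (s t : Fin m → Fin k) where
    open Multigraph s t

    private
      -- Requiring `x` below `y` selects one orientation of each linked pair, which rules out loops
      -- and parallel edges.
      linkedPair? : (xy : Fin k × Fin k) → Dec (proj₁ xy Fin.< proj₂ xy × uncurry Linked xy)
      linkedPair? (x , y) = (x Fin.<? y) ×-dec linked? x y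

      pairs : List (Fin k × Fin k)
      pairs = filter linkedPair? (cartesianProduct (allFin k) (allFin k))

      pair : Fin (length pairs) → Fin k × Fin k
      pair = List.lookup pairs

      pair-< : ∀ e → proj₁ (pair e) Fin.< proj₂ (pair e)
      pair-< e = proj₁ (proj₂ (∈-filter⁻ linkedPair? {xs = cartesianProduct (allFin k) (allFin k)} (∈-lookup e)))

      pair-linked : ∀ e → uncurry Linked (pair e)
      pair-linked e = proj₂ (proj₂ (∈-filter⁻ linkedPair? {xs = cartesianProduct (allFin k) (allFin k)} (∈-lookup e)))

      pair-injective : ∀ {e f} → pair e ≡ pair f → e ≡ f
      pair-injective = lookup-injective
        (Unique.filter⁺ linkedPair? (Unique.cartesianProduct⁺ (Unique.allFin⁺ k) (Unique.allFin⁺ k))) _ _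

      pair-complete : ∀ {x y} → x Fin.< y → Linked x y → ∃[ e ] pair e ≡ (x , y)
      pair-complete {x} {y} x<y l = Any.index xy∈ , sym (lookup-index xy∈)
        where
        xy∈ : (x , y) ∈ pairs
        xy∈ = ∈-filter⁺ linkedPair? (∈-cartesianProduct⁺ (∈-allFin x) (∈-allFin y)) (x<y , l)

    Linked-sym : ∀ {x y} → Linked x y → Linked y x
    Linked-sym (x≢y , e , inj₁ b) = x≢y ∘ sym , e , inj₂ b
    Linked-sym (x≢y , e , inj₂ b) = x≢y ∘ sym , e , inj₁ b

    simplification : Graph
    simplification = record
      { ∣V∣      = k
      ; ∣E∣      = length pairs
      ; src      = proj₁ ∘ pair
      ; tgt      = proj₂ ∘ pair
      ; loopless = λ e → Fin.<⇒≢ (pair-< e)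
      ; simple   = simple
      }
      where
      Joins′ : Fin (length pairs) → Fin k → Fin k → Set
      Joins′ e x y = (proj₁ (pair e) ≡ x × proj₂ (pair e) ≡ y) ⊎ (proj₁ (pair e) ≡ y × proj₂ (pair e) ≡ x)

      simple : ∀ {e f x y} → Joins′ e x y → Joins′ f x y → e ≡ f
      simple {e} {f} (inj₁ (refl , refl)) (inj₁ (p , q)) = pair-injective (sym (cong₂ _,_ p q))
      -- Opposite orientations are impossible, since both pairs ascend.
      simple {e} {f} (inj₁ (refl , refl)) (inj₂ (p , q)) =
        contradiction (pair-< f) (subst₂ (λ a b → ¬ (a Fin.< b)) (sym p) (sym q) (Fin.<-asym (pair-< e)))
      simple {e} {f} (inj₂ (refl , refl)) (inj₁ (p , q)) =
        contradiction (pair-< f) (subst₂ (λ a b → ¬ (a Fin.< b)) (sym p) (sym q) (Fin.<-asym (pair-< e)))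
      simple {e} {f} (inj₂ (refl , refl)) (inj₂ (p , q)) = pair-injective (sym (cong₂ _,_ p q))

    Adjacent⇔Linked : ∀ x y → Adjacent simplification x y ⇔ Linked x y
    Adjacent⇔Linked x y = mk⇔ to from
      where
      to : Adjacent simplification x y → Linked x y
      to (e , inj₁ (refl , refl)) = pair-linked e
      to (e , inj₂ (refl , refl)) = Linked-sym (pair-linked e)
      from : Linked x y → Adjacent simplification x y
      from l with Fin.<-cmp x y
      ... | tri≈ _ x≡y _ = contradiction x≡y (proj₁ l)
      ... | tri< x<y _ _ with pair-complete x<y l
      ...   | e , eq = e , inj₁ (cong proj₁ eq , cong proj₂ eq)
      from l | tri> _ _ y<x with pair-complete y<x (Linked-sym l)
      ...   | e , eq = e , inj₂ (cong proj₁ eq , cong proj₂ eq)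

  -- Contractions of the moldgraph.

  -- Vertices of G with equal labels are contracted to one vertex.
  Labelling : Graph → Set
  Labelling G = ∃[ k ] (Vertex G → Fin k)

  module Contraction (G : Graph) where

    module Quotient ((k , φ) : Labelling G) = Multigraph (φ ∘ src G) (φ ∘ tgt G)

    Crosses : Labelling G → Edge G → Set
    Crosses (_ , φ) e = φ (src G e) ≢ φ (tgt G e)

    crosses? : ∀ L e → Dec (Crosses L e)
    crosses? (_ , φ) e = ¬? (φ (src G e) ≟ φ (tgt G e))

    crossings : Labelling G → ℕ
    crossings L = ∑ (λ e → 𝟙 (crosses? L e))

    star : Labelling G → List (Edge G)
    star (zero  , φ) = []
    star (suc k , φ) = Quotient.leaving (suc k , φ) (Hub.hub (φ ∘ src G) (φ ∘ tgt G))

    merged : (L : Labelling G) (e : Edge G) → Crosses L e → Labelling G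
    merged (k , φ) e cross = pred k , merge cross ∘ φ

    -- Made total because a state is computed for every history, also for those that cannot occur.
    contract : Labelling G → Edge G → Labelling G
    contract L e with crosses? L e
    ... | yes cross = merged L e cross
    ... | no  _     = L

    -- The premise quantifies over `cross`, as the proof that `crosses?` finds need not be the given
    -- one.
    contract-elim : ∀ {ℓ} (P : Labelling G → Set ℓ) L e → Crosses L e →
                    (∀ cross → P (merged L e cross)) → P (contract L e)
    contract-elim P L e cross p with crosses? L e
    ... | yes cross′ = p cross′
    ... | no ¬cross  = contradiction cross ¬cross

    between⇒crosses : ∀ {k} (φ : Vertex G → Fin k) {e x y} → x ≢ y →
                      Quotient.Between (k , φ) e x y → Crosses (k , φ) e
    between⇒crosses φ x≢y (inj₁ (refl , refl)) = x≢y
    between⇒crosses φ x≢y (inj₂ (refl , refl)) = x≢y ∘ sym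

    star-crosses : ∀ L {e} → e ∈ star L → Crosses L e
    star-crosses L@(suc k , φ) e∈ with Quotient.∈-leaving⁻ L _ e∈
    ... | y , _ , x≢y , b = between⇒crosses φ x≢y b

    parallel-merged : ∀ {k} (φ : Vertex G → Fin k) {e f x y} →
                      Quotient.Between (k , φ) e x y → Quotient.Between (k , φ) f x y →
                      ∀ cross → ¬ Crosses (merged (k , φ) e cross) f
    parallel-merged φ (inj₁ (refl , refl)) (inj₁ (p , q)) c ne rewrite p | q = ne (merge-identifies c)
    parallel-merged φ (inj₁ (refl , refl)) (inj₂ (p , q)) c ne rewrite p | q = ne (sym (merge-identifies c))
    parallel-merged φ (inj₂ (refl , refl)) (inj₁ (p , q)) c ne rewrite p | q = ne (sym (merge-identifies c))
    parallel-merged φ (inj₂ (refl , refl)) (inj₂ (p , q)) c ne rewrite p | q = ne (merge-identifies c)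

    -- The edges parallel to `e` become loops and no loop becomes a crossing edge, so the left side
    -- counts disjoint sets of edges that cross in `L`.
    width+crossings : ∀ {k} (φ : Vertex G → Fin k) {e x y} → x ≢ y → Quotient.Between (k , φ) e x y →
                      Quotient.width (k , φ) x y + crossings (contract (k , φ) e) ≤ crossings (k , φ)
    width+crossings {k} φ {e} {x} {y} x≢y b =
      contract-elim (λ L′ → width x y + crossings L′ ≤ crossings L) L e (between⇒crosses φ x≢y b) bound
      where
      L = k , φ
      open Quotient L
      bound : ∀ cross → width x y + crossings (merged L e cross) ≤ crossings L
      bound cross = begin
        width x y + crossings L′
          ≡⟨ cong (_+ crossings L′) (length-filter (λ f → between? f x y) id) ⟩
        ∑ (λ f → 𝟙 (between? f x y)) + crossings L′
          ≡⟨ ∑-distrib-+ (λ f → 𝟙 (between? f x y)) (λ f → 𝟙 (crosses? L′ f)) ⟨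
        ∑ (λ f → 𝟙 (between? f x y) + 𝟙 (crosses? L′ f))
          ≤⟨ ∑-mono (λ f → pointwise f (between? f x y) (crosses? L′ f)) ⟩
        crossings L                                             ∎
        where
        open ≤-Reasoning
        L′ = merged L e cross
        pointwise : ∀ f (B? : Dec (Between f x y)) (C? : Dec (Crosses L′ f)) → 𝟙 B? + 𝟙 C? ≤ 𝟙 (crosses? L f)
        pointwise f (yes b′) (yes c) = contradiction c (parallel-merged φ b b′ cross)
        pointwise f (yes b′) (no _)  = 𝟙-mono (yes b′) (crosses? L f) (between⇒crosses φ x≢y)
        pointwise f (no _)   C?      = 𝟙-mono C? (crosses? L f) (λ c eq → c (cong (merge cross) eq))

    -- Only adjacency is compared and the edges of `H` are named freely, so that `G` with the
    -- identity qualifies at the start.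
    Represents : (H : Graph) → (Vertex G → Vertex H) → Set
    Represents H φ = ∀ x y → Adjacent H x y ⇔ Quotient.Linked (∣V∣ H , φ) x y

    -- All edges of `G` parallel to `e` correspond to a single edge `f` of `H`, and contracting `f`
    -- is the minor operation that merges the two labels.
    contraction-step : ∀ {H} (φ : Vertex G → Vertex H) → Represents H φ → ∀ {e} cross →
                       let L = merged (∣V∣ H , φ) e cross in
                       H ⟶ simplification (proj₂ L ∘ src G) (proj₂ L ∘ tgt G)
    contraction-step {H} φ represents {e} cross
      with Equivalence.from (represents (φ (src G e)) (φ (tgt G e))) (cross , e , inj₁ (refl , refl))
    ... | f , f-joins = contractEdge f (merge cross)
      (λ z → let u , eq = merge-surjective cross z in u , λ { refl → eq })
      (λ u v → mk⇔ (splits f-joins ∘ merge-injective cross) (identified f-joins))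
      (λ x y → mk⇔ (λ a → below (Equivalence.to (Adjacent⇔Linked _ _ x y) a))
                   (λ a → Equivalence.from (Adjacent⇔Linked _ _ x y) (above a)))
      where
      s = φ (src G e)
      t = φ (tgt G e)
      splits : Joins H f s t → ∀ {u v} → u ≡ v ⊎ (s ≡ u × t ≡ v) ⊎ (s ≡ v × t ≡ u) → u ≡ v ⊎ Joins H f u v
      splits j        (inj₁ u≡v)                  = inj₁ u≡v
      splits j        (inj₂ (inj₁ (refl , refl))) = inj₂ j
      splits (inj₁ j) (inj₂ (inj₂ (refl , refl))) = inj₂ (inj₂ j)
      splits (inj₂ j) (inj₂ (inj₂ (refl , refl))) = inj₂ (inj₁ j)
      identified : Joins H f s t → ∀ {u v} → u ≡ v ⊎ Joins H f u v → merge cross u ≡ merge cross v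
      identified _ (inj₁ refl) = refl
      identified (inj₁ (p , q)) (inj₂ (inj₁ (refl , refl))) rewrite p | q = merge-identifies cross
      identified (inj₁ (p , q)) (inj₂ (inj₂ (refl , refl))) rewrite p | q = sym (merge-identifies cross)
      identified (inj₂ (p , q)) (inj₂ (inj₁ (refl , refl))) rewrite p | q = sym (merge-identifies cross)
      identified (inj₂ (p , q)) (inj₂ (inj₂ (refl , refl))) rewrite p | q = merge-identifies cross
      module Q′ = Quotient (merged (∣V∣ H , φ) e cross)
      below : ∀ {x y} → Q′.Linked x y →
              x ≢ y × ∃[ u ] ∃[ v ] merge cross u ≡ x × merge cross v ≡ y × Adjacent H u v
      below (x≢y , g , inj₁ (refl , refl)) = x≢y , _ , _ , refl , refl ,
        Equivalence.from (represents _ _) (x≢y ∘ cong (merge cross) , g , inj₁ (refl , refl))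
      below (x≢y , g , inj₂ (refl , refl)) = x≢y , _ , _ , refl , refl ,
        Equivalence.from (represents _ _) (x≢y ∘ cong (merge cross) , g , inj₂ (refl , refl))
      above : ∀ {x y} → x ≢ y × (∃[ u ] ∃[ v ] merge cross u ≡ x × merge cross v ≡ y × Adjacent H u v) →
              Q′.Linked x y
      above (x≢y , u , v , refl , refl , a) with Equivalence.to (represents u v) a
      ... | _ , g , inj₁ (refl , refl) = x≢y , g , inj₁ (refl , refl)
      ... | _ , g , inj₂ (refl , refl) = x≢y , g , inj₂ (refl , refl)

    Onto : Labelling G → Set
    Onto (_ , φ) = ∀ x → ∃[ u ] φ u ≡ x

    contract-onto : ∀ L e → Crosses L e → Onto L → Onto (contract L e)
    contract-onto L@(_ , φ) e cross onto = contract-elim Onto L e cross onto′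
      where
      onto′ : ∀ cross → Onto (merged L e cross)
      onto′ cross z with merge-surjective cross z
      ... | x , refl with onto x
      ...   | u , refl = u , refl

    contract-size : ∀ L e → Crosses L e → proj₁ (contract L e) ≡ pred (proj₁ L)
    contract-size L e cross = contract-elim (λ L′ → proj₁ L′ ≡ pred (proj₁ L)) L e cross (λ _ → refl)

    module _ (R : SpanningSubgraph G) where

      delay : Labelling G → ℕ
      delay L = firstHit R (star L)

      star⇒load>0 : ∀ {k} (φ : Vertex G → Fin (suc k)) {e} → e ∈ star (suc k , φ) →
                     0 < Quotient.load (suc k , φ) (Hub.hub (φ ∘ src G) (φ ∘ tgt G))
      star⇒load>0 {k} φ e∈ = nonEmpty e∈
        where
        nonEmpty : ∀ {es : List (Edge G)} {e} → e ∈ es → 0 < length es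
        nonEmpty {_ ∷ _} _ = s≤s z≤n

      -- The load of the hub is at most twice the average, and the total is at most `2 * ∣E∣ G`. The
      -- edge `e` shows that the star is nonempty, hence the hub has positive degree.
      delay-load : ∀ L {e} → e ∈ star L → proj₁ L * delay L ≤ 4 * ∣E∣ G
      delay-load L@(suc k , φ) e∈ = begin
        suc k * delay L       ≤⟨ *-monoʳ-≤ (suc k) (firstHit≤length R (star L)) ⟩
        suc k * load hub      ≤⟨ load-hub (load>0⇒degree>0 hub (star⇒load>0 φ e∈)) ⟩
        2 * ∑ load            ≤⟨ *-monoʳ-≤ 2 ∑-load≤ ⟩
        2 * (2 * ∣E∣ G)       ≡⟨ *-assoc 2 2 (∣E∣ G) ⟨
        4 * ∣E∣ G             ∎
        where
        open ≤-Reasoning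
        open Quotient L
        open Hub (φ ∘ src G) (φ ∘ tgt G)

      -- Here `d` is the degree of the hub and `w` the width of the bundle of `e`: the `w` crossing
      -- edges lost by contracting `e` pay for the delay, up to the factor `d`.
      delay-degree : ∀ L {e} → e ∈ star L → Vec.lookup R e ≡ true →
                     ∃[ d ] ∃[ w ] proj₁ L * d ≤ 2 * ∑ (Quotient.degree L)
                                 × delay L ≤ d * w
                                 × w + crossings (contract L e) ≤ crossings L
      delay-degree L@(suc k , φ) {e} e∈ hit with Quotient.∈-leaving⁻ L _ e∈
      ... | y , y∈ , x≢y , b = degree hub , width hub y
        , degree-hub (star⇒load>0 φ e∈) , firstHit-leaving R y∈ b hit , width+crossings φ x≢y b
        where
        open Quotient L
        open Hub (φ ∘ src G) (φ ∘ tgt G)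

      -- A realized walk from the class of the hub to another class has a first edge that leaves the
      -- former, and this edge lies in the star.
      star-hit : ∀ L → Onto L → 2 ≤ proj₁ L → Connected G R →
                 ∃[ e ] e ∈ star L × e Subset.∈ R
      star-hit (suc zero , _) _ (s≤s ()) _
      star-hit L@(suc (suc k) , φ) onto _ connected with Hub.hub (φ ∘ src G) (φ ∘ tgt G)
      ... | x with onto x | onto (punchIn x zero)
      -- `u` has the label of the hub, and `punchIn x zero` is some other label.
      ...   | u , refl | v , φv≡ = exit (connected u v) refl λ φv≡φu → punchInᵢ≢i (φ u) zero (trans (sym φv≡) φv≡φu)
        where
        exit : ∀ {w} → Walk G R w v → φ w ≡ φ u → φ v ≢ φ u →
               ∃[ e ] e ∈ Quotient.leaving L (φ u) × e Subset.∈ R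
        exit [] eq ne = contradiction eq ne
        exit (step {v = w′} e e∈R j walk) eq ne with φ w′ ≟ φ u
        ... | yes eq′ = exit walk eq′ ne
        ... | no ne′  = e , Quotient.∈-leaving⁺ L (ne′ ∘ sym)
          (subst (λ x → Quotient.Between L e x (φ w′)) eq (between j)) , e∈R
          where
          between : ∀ {w w′} → Joins G e w w′ → Quotient.Between L e (φ w) (φ w′)
          between (inj₁ (refl , refl)) = inj₁ (refl , refl)
          between (inj₂ (refl , refl)) = inj₂ (refl , refl)

  -- Walks after adding one edge.

  module _ {G : Graph} where

    infixr 5 _++ʷ_
    _++ʷ_ : ∀ {S u v w} → Walk G S u v → Walk G S v w → Walk G S u w
    []             ++ʷ q = q
    step e e∈ j p  ++ʷ q = step e e∈ j (p ++ʷ q)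

    widen : ∀ {S S′ u v} → S Subset.⊆ S′ → Walk G S u v → Walk G S′ u v
    widen S⊆ []              = []
    widen S⊆ (step e e∈ j p) = step e (S⊆ e∈) j (widen S⊆ p)

    module _ {T : SpanningSubgraph G} {e : Edge G} where

      private
        T+e : SpanningSubgraph G
        T+e = T ∪ ⁅ e ⁆

      -- The lists of edges and vertices are preserved so that a cycle avoiding `e` is still a cycle
      -- in `T`.
      avoiding : ∀ {u v} (p : Walk G T+e u v) → e ∉ edges G T+e p →
                 Σ[ q ∈ Walk G T u v ] edges G T q ≡ edges G T+e p × vertices G T q ≡ vertices G T+e p
      avoiding [] _ = [] , refl , refl
      avoiding (step {u} f f∈ j p) e∉ with x∈p∪q⁻ T ⁅ e ⁆ f∈ | avoiding p (e∉ ∘ there)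
      ... | inj₁ f∈T | q , es , vs = step f f∈T j q , cong (f ∷_) es , cong (u ∷_) vs
      ... | inj₂ f∈e | _           = contradiction (here (sym (x∈⁅y⁆⇒x≡y e f∈e))) e∉

      -- As the edges are distinct, `e` occurs once, and the pieces on both sides of it stay in `T`.
      crossing : ∀ {u v} (p : Walk G T+e u v) → Unique (edges G T+e p) → e ∈ edges G T+e p →
                 ∃[ x ] ∃[ y ] Joins G e x y × Walk G T u x × Walk G T y v
      crossing (step f f∈ j p) (f≢ ∷ _) (here refl) =
        _ , _ , j , [] , proj₁ (avoiding p (λ e∈ → All.lookup f≢ e∈ refl))
      crossing (step f f∈ j p) (f≢ ∷ unique) (there e∈) with x∈p∪q⁻ T ⁅ e ⁆ f∈ | crossing p unique e∈
      ... | inj₁ f∈T | x , y , j′ , q , r = x , y , j′ , step f f∈T j q , r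
      ... | inj₂ f∈e | _                  = contradiction (x∈⁅y⁆⇒x≡y e f∈e) (All.lookup f≢ e∈)

  -- The algorithm as a state machine.

  module Borůvka (G : Graph) where
    open Contraction G
    open DecMembership (_≟_ {∣E∣ G}) using (_∈?_)

    -- The next answer concerns the head of pending, which is a suffix of the
    -- first budget edges of the star.
    record State : Set where
      constructor ⟨_,_,_,_⟩
      field
        labelling : Labelling G
        forest    : SpanningSubgraph G
        budget    : ℕ
        pending   : List (Edge G)
    open State public

    pass : Labelling G → SpanningSubgraph G → ℕ → State
    pass L T b = ⟨ L , T , b , take b (star L) ⟩

    resume : Labelling G → SpanningSubgraph G → ℕ → List (Edge G) → State
    resume L T b []         = pass L T (2 * b)
    resume L T b es@(_ ∷ _) = ⟨ L , T , b , es ⟩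

    answered : State → Edge G → Answer → State
    answered ⟨ L , T , b , es ⟩ e Yes = pass (contract L e) (T ∪ ⁅ e ⁆) 1
    answered ⟨ L , T , b , es ⟩ e No  = resume L T b (List.drop 1 es)

    initial : Labelling G
    initial = ∣V∣ G , id

    -- An algorithm sees nothing but the answers, so the state is recovered by replaying them.
    state : History G → State
    state []            = pass initial Subset.⊥ 1
    state ((e , a) ∷ h) = answered (state h) e a

    action : State → Action G
    action ⟨ _ , T , _ , [] ⟩    = output T
    action ⟨ _ , _ , _ , e ∷ _ ⟩ = query e

    algorithm : Algorithm G
    algorithm = action ∘ state

    -- Correctness of the output.

    module Correctness (R : SpanningSubgraph G) (connected : Connected G R) where

      -- By `respects` and `joined`, the label classes are exactly the components of the forest.
      record Spans (L : Labelling G) (T : SpanningSubgraph G) : Set where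
        field
          onto     : Onto L
          realized : T Subset.⊆ R
          acyclic  : Acyclic G T
          respects : ∀ {u v} → Walk G T u v → proj₂ L u ≡ proj₂ L v
          joined   : ∀ {u v} → proj₂ L u ≡ proj₂ L v → Walk G T u v
      open Spans

      spans-initial : Spans initial Subset.⊥
      spans-initial .onto x = x , refl
      spans-initial .realized = λ e∈ → contradiction e∈ ∉⊥
      spans-initial .acyclic [] (nonEmpty , _) = nonEmpty refl
      spans-initial .acyclic (step _ e∈ _ _) = contradiction e∈ ∉⊥
      spans-initial .respects [] = refl
      spans-initial .respects (step _ e∈ _ _) = contradiction e∈ ∉⊥
      spans-initial .joined refl = []

      -- A crossing edge connects two components of the forest, so it closes no cycle and its
      -- addition unites just these two.
      spans-contract : ∀ {L T e} → Crosses L e → e Subset.∈ R → Spans L T →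
                       Spans (contract L e) (T ∪ ⁅ e ⁆)
      spans-contract {L@(_ , φ)} {T} {e} cross e∈R I =
        contract-elim (λ L′ → Spans L′ (T ∪ ⁅ e ⁆)) L e cross extended
        where
        acyclic′ : Acyclic G (T ∪ ⁅ e ⁆)
        acyclic′ p (nonEmpty , unique-e , unique-v) with e ∈? edges G (T ∪ ⁅ e ⁆) p
        ... | no e∉ with avoiding p e∉
        ...   | q , es , vs = acyclic I q
          ( nonEmpty ∘ trans (sym es)
          , subst Unique (sym es) unique-e , subst Unique (sym vs) unique-v)
        acyclic′ p (_ , unique-e , _) | yes e∈ with crossing p unique-e e∈
        -- A cycle through `e` would join the ends of `e` within `T` and give them equal labels.
        ... | _ , _ , inj₁ (refl , refl) , q , r = cross (trans (sym (respects I q)) (sym (respects I r)))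
        ... | _ , _ , inj₂ (refl , refl) , q , r = cross (trans (respects I r) (respects I q))

        bridge : Walk G (T ∪ ⁅ e ⁆) (src G e) (tgt G e)
        bridge = step e (x∈p∪q⁺ (inj₂ (x∈⁅x⁆ e))) (inj₁ (refl , refl)) []
        bridge⁻¹ : Walk G (T ∪ ⁅ e ⁆) (tgt G e) (src G e)
        bridge⁻¹ = step e (x∈p∪q⁺ (inj₂ (x∈⁅x⁆ e))) (inj₂ (refl , refl)) []

        wide : ∀ {u v} → φ u ≡ φ v → Walk G (T ∪ ⁅ e ⁆) u v
        wide eq = widen (p⊆p∪q ⁅ e ⁆) (joined I eq)

        extended : ∀ cross → Spans (merged L e cross) (T ∪ ⁅ e ⁆)
        extended c .onto z with merge-surjective c z
        ... | x , refl with onto I x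
        ...   | u , refl = u , refl
        extended c .realized f∈ with x∈p∪q⁻ T ⁅ e ⁆ f∈
        ... | inj₁ f∈T = realized I f∈T
        ... | inj₂ f∈e with x∈⁅y⁆⇒x≡y e f∈e
        ...   | refl = e∈R
        extended c .acyclic = acyclic′
        extended c .respects [] = refl
        extended c .respects (step f f∈ j p) with x∈p∪q⁻ T ⁅ e ⁆ f∈
        ... | inj₁ f∈T = trans (cong (merge c) (respects I (step f f∈T j []))) (extended c .respects p)
        ... | inj₂ f∈e with x∈⁅y⁆⇒x≡y e f∈e | j
        ...   | refl | inj₁ (refl , refl) = trans (merge-identifies c) (extended c .respects p)
        ...   | refl | inj₂ (refl , refl) = trans (sym (merge-identifies c)) (extended c .respects p)
        extended c .joined eq with merge-injective c eq
        ... | inj₁ same            = wide same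
        -- Labels that become equal without having been so are those of the ends of `e`, and the
        -- walk uses `e` as a bridge.
        ... | inj₂ (inj₁ (p , q)) = wide (sym p) ++ʷ bridge ++ʷ wide q
        ... | inj₂ (inj₂ (p , q)) = wide (sym q) ++ʷ bridge⁻¹ ++ʷ wide p

      -- `stops` separates the end of a pass from the end of the algorithm: with a positive budget,
      -- a new pass is empty only if the star is.
      record Invariant (s : State) : Set where
        field
          spans    : Spans (labelling s) (forest s)
          budget>0 : 0 < budget s
          within   : pending s ⊆ star (labelling s)
          stops    : pending s ≡ [] → star (labelling s) ≡ []
      open Invariant

      take-⊆ : ∀ b (es : List (Edge G)) → take b es ⊆ es
      take-⊆ (suc b) (e ∷ es) (here px)  = here px
      take-⊆ (suc b) (e ∷ es) (there e∈) = there (take-⊆ b es e∈)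

      pass-invariant : ∀ {L T b} → Spans L T → 0 < b → Invariant (pass L T b)
      pass-invariant I 0<b .spans = I
      pass-invariant I 0<b .budget>0 = 0<b
      pass-invariant {L} {b = b} I 0<b .within = take-⊆ b (star L)
      pass-invariant {L} {b = suc _} I 0<b .stops eq with star L
      ... | [] = refl

      -- One-sidedness enters through the last hypothesis: a Yes certifies the edge, while a No
      -- certifies nothing.
      answered-invariant : ∀ {s e a} → Invariant s → action s ≡ query e → (a ≡ Yes → e Subset.∈ R) →
                       Invariant (answered s e a)
      answered-invariant {⟨ _ , _ , _ , e ∷ es ⟩} {a = Yes} I refl hit =
        pass-invariant (spans-contract (star-crosses _ (within I (here refl))) (hit refl) (spans I)) (s≤s z≤n)
      answered-invariant {⟨ _ , _ , b , e ∷ [] ⟩} {a = No} I refl _ =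
        pass-invariant (spans I) (≤-trans (budget>0 I) (m≤m+n b _))
      answered-invariant {⟨ _ , _ , _ , e ∷ _ ∷ _ ⟩} {a = No} I refl _ = record
        { spans = spans I ; budget>0 = budget>0 I ; within = within I ∘ there ; stops = λ () }

      -- On stopping the star is empty, so by `star-hit` fewer than two labels remain, and vertices
      -- of equal label are joined in the forest.
      output-correct : ∀ {s T} → Invariant s → action s ≡ output T → IsSpanningTree G T × T Subset.⊆ R
      output-correct {⟨ L , T , _ , [] ⟩} I refl = (connects , acyclic (spans I)) , realized (spans I)
        where
        one-label : ∀ (L : Labelling G) → ¬ (2 ≤ proj₁ L) → ∀ u v → proj₂ L u ≡ proj₂ L v
        one-label (zero , φ) _ u _ with φ u
        ... | ()
        one-label (suc zero , φ) _ u v with φ u | φ v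
        ... | zero | zero = refl
        one-label (suc (suc _) , _) few = contradiction (s≤s (s≤s z≤n)) few
        few : ¬ (2 ≤ proj₁ L)
        few 2≤k with star-hit R L (onto (spans I)) 2≤k connected
        ... | e , e∈ , _ with star L | stops I refl
        few 2≤k | e , () , _ | .[] | refl
        connects : Connected G T
        connects u v = joined (spans I) (one-label L few u v)

  -- Rounded harmonic sums.

  module _ (M : ℕ) where
    open ≤-Reasoning

    -- The sum of the rounded quotients `M / i` for `i` from 2 to `k`. It starts at 2 because a
    -- single label leaves nothing to query.
    harmonic : ℕ → ℕ
    harmonic zero          = 0
    harmonic (suc zero)    = 0
    harmonic (suc (suc k)) = harmonic (suc k) + M / suc (suc k)

    harmonic-mono : ∀ {j k} → j ≤ k → harmonic j ≤ harmonic k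
    harmonic-mono j≤k = go (≤⇒≤′ j≤k)
      where
      grow : ∀ k → harmonic k ≤ harmonic (suc k)
      grow zero    = z≤n
      grow (suc k) = m≤m+n _ _
      go : ∀ {j k} → j ≤′ k → harmonic j ≤ harmonic k
      go ≤′-refl        = ≤-refl
      go (≤′-step {n} j≤k) = ≤-trans (go j≤k) (grow n)

    private
      pair-≤ : ∀ j .{{_ : NonZero j}} .{{_ : NonZero (j * 2)}} → M / (j * 2) + M / suc (j * 2) ≤ M / j
      pair-≤ j = begin
        M / (j * 2) + M / suc (j * 2)  ≤⟨ +-monoʳ-≤ (M / (j * 2)) (/-monoʳ-≤ M (n≤1+n (j * 2))) ⟩
        M / (j * 2) + M / (j * 2)
          ≡⟨ Nat-Solver.solve 1 (λ x → x Nat-Solver.:+ x Nat-Solver.:= x Nat-Solver.:* Nat-Solver.con 2) refl (M / (j * 2)) ⟩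
        M / (j * 2) * 2                ≡⟨ cong (_* 2) (m/n/o≡m/[n*o] M j 2) ⟨
        M / j / 2 * 2                  ≤⟨ m/n*n≤m (M / j) 2 ⟩
        M / j                          ∎

    -- The terms of index `2 i` and `2 i + 1` together are at most `M / i`; the group of `i = 1`
    -- yields the summand `M`.
    harmonic-double : ∀ j → harmonic (suc (suc j * 2)) ≤ M + harmonic (suc j)
    harmonic-double zero = ≤-trans (pair-≤ 1) (≤-trans (≤-reflexive (n/1≡n M)) (m≤m+n M 0))
    harmonic-double (suc j) = begin
      harmonic (suc (suc j * 2)) + M / (2 + suc j * 2) + M / (3 + suc j * 2)
        ≡⟨ +-assoc (harmonic (suc (suc j * 2))) _ _ ⟩
      harmonic (suc (suc j * 2)) + (M / (2 + suc j * 2) + M / (3 + suc j * 2))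
        ≤⟨ +-mono-≤ (harmonic-double j) (pair-≤ (suc (suc j))) ⟩
      M + harmonic (suc j) + M / suc (suc j)
        ≡⟨ +-assoc M _ _ ⟩
      M + harmonic (suc (suc j)) ∎

    -- Each halving of `k` costs one `M` and lowers the logarithm by one.
    harmonic-log : ∀ k → harmonic k ≤ M * ⌊log₂ k ⌋
    harmonic-log = <-rec _ bound
      where
      bound : ∀ k → (∀ {j} → j < k → harmonic j ≤ M * ⌊log₂ j ⌋) → harmonic k ≤ M * ⌊log₂ k ⌋
      bound zero          _   = z≤n
      bound (suc zero)    _   = z≤n
      bound k@(suc (suc k′)) rec with k / 2 in half | m≡m%n+[m/n]*n k 2
      ... | zero  | eq = contradiction (subst (_< 2) (sym (trans eq (+-identityʳ _))) (m%n<n k 2)) (λ { (s≤s (s≤s ())) })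
      ... | suc j | eq = begin
        harmonic k                       ≤⟨ harmonic-mono upper ⟩
        harmonic (suc (suc j * 2))       ≤⟨ harmonic-double j ⟩
        M + harmonic (suc j)             ≤⟨ +-monoʳ-≤ M (rec smaller) ⟩
        M + M * ⌊log₂ suc j ⌋            ≡⟨ *-suc M _ ⟨
        M * suc ⌊log₂ suc j ⌋            ≡⟨ cong (M *_) (⌊log₂[2*b]⌋≡1+⌊log₂b⌋ (suc j)) ⟨
        M * ⌊log₂ 2 * suc j ⌋
          ≤⟨ *-monoʳ-≤ M (⌊log₂⌋-mono-≤ (subst (_≤ k) (*-comm (suc j) 2) lower)) ⟩
        M * ⌊log₂ k ⌋                    ∎
        where
        lower : suc j * 2 ≤ k
        lower = ≤-trans (m≤n+m (suc j * 2) (k % 2)) (≤-reflexive (sym eq))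
        upper : k ≤ suc (suc j * 2)
        upper = ≤-trans (≤-reflexive eq) (+-monoˡ-≤ (suc j * 2) (s≤s⁻¹ (m%n<n k 2)))
        smaller : suc j < k
        smaller = ≤-trans (s≤s (s≤s (m≤m*n j 2))) lower

-- Arithmetic in an ordered field.

module OrderedFieldProperties {c ℓ₁ ℓ₂ ℓ₃} (K : ArchimedeanOrderedField c ℓ₁ ℓ₂ ℓ₃) where
  open ArchimedeanOrderedField K renaming (refl to ≈-refl)
  open NaturalCoefficients commutativeSemiring using (solve; _:=_; _:+_; _:*_)

  poset : Poset _ _ _
  poset = record { isPartialOrder = ≤-isPartialOrder }

  open PartialOrderReasoning poset
  open IsPartialOrder ≤-isPartialOrder public
    using () renaming (refl to ≤-refl; trans to ≤-trans; reflexive to ≤-reflexive)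

  <⇒≤ : ∀ {x y} → x < y → x ≤ y
  <⇒≤ x<y = Equivalence.from ≤⇔≯ (IsStrictPartialOrder.asym <-isStrictPartialOrder x<y)

  0≤1 : 0# ≤ 1#
  0≤1 = <⇒≤ 0<1

  +-monoʳ-≤ : ∀ z {x y} → x ≤ y → z + x ≤ z + y
  +-monoʳ-≤ z {x} {y} x≤y = begin
    z + x  ≈⟨ +-comm z x ⟩
    x + z  ≤⟨ +-monoˡ-≤ z x≤y ⟩
    y + z  ≈⟨ +-comm y z ⟩
    z + y  ∎

  +-mono-≤ : ∀ {x y u v} → x ≤ y → u ≤ v → x + u ≤ y + v
  +-mono-≤ {y = y} {u} x≤y u≤v = ≤-trans (+-monoˡ-≤ u x≤y) (+-monoʳ-≤ y u≤v)

  +-nonNegative : ∀ {x y} → 0# ≤ x → 0# ≤ y → 0# ≤ x + y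
  +-nonNegative 0≤x 0≤y = ≤-trans (≤-reflexive (sym (+-identityˡ 0#))) (+-mono-≤ 0≤x 0≤y)

  x+[y-x]≈y : ∀ x y → x + (y - x) ≈ y
  x+[y-x]≈y x y = begin-equality
    x + (y - x)     ≈⟨ +-comm x (y - x) ⟩
    (y - x) + x     ≈⟨ +-assoc y (- x) x ⟩
    y + (- x + x)   ≈⟨ +-congˡ (-‿inverseˡ x) ⟩
    y + 0#          ≈⟨ +-identityʳ y ⟩
    y               ∎

  -‿nonNegative : ∀ {x y} → x ≤ y → 0# ≤ y - x
  -‿nonNegative {x} {y} x≤y = begin
    0#     ≈⟨ -‿inverseʳ x ⟨
    x - x  ≤⟨ +-monoˡ-≤ (- x) x≤y ⟩
    y - x  ∎

  *-monoʳ-≤ : ∀ {z x y} → 0# ≤ z → x ≤ y → z * x ≤ z * y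
  *-monoʳ-≤ {z} {x} {y} 0≤z x≤y = begin
    z * x                  ≈⟨ +-identityʳ (z * x) ⟨
    z * x + 0#             ≤⟨ +-monoʳ-≤ (z * x) (*-nonNegative 0≤z (-‿nonNegative x≤y)) ⟩
    z * x + z * (y - x)    ≈⟨ distribˡ z x (y - x) ⟨
    z * (x + (y - x))      ≈⟨ *-congˡ (x+[y-x]≈y x y) ⟩
    z * y                  ∎

  *-monoˡ-≤ : ∀ {z x y} → 0# ≤ z → x ≤ y → x * z ≤ y * z
  *-monoˡ-≤ {z} {x} {y} 0≤z x≤y = begin
    x * z  ≈⟨ *-comm x z ⟩
    z * x  ≤⟨ *-monoʳ-≤ 0≤z x≤y ⟩
    z * y  ≈⟨ *-comm z y ⟩
    y * z  ∎

  *-monoʳ-< : ∀ {z x y} → 0# < z → x < y → z * x < z * y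
  *-monoʳ-< {z} {x} {y} 0<z x<y = <-respˡ-≈ (+-identityʳ (z * x)) (<-respʳ-≈ split
    (<-respˡ-≈ (+-comm 0# (z * x)) (<-respʳ-≈ (+-comm (z * (y - x)) (z * x))
      (+-monoˡ-< (z * x) (*-positive 0<z (<-respˡ-≈ (-‿inverseʳ x) (+-monoˡ-< (- x) x<y)))))))
    where
    open IsStrictPartialOrder <-isStrictPartialOrder using (<-respˡ-≈; <-respʳ-≈)
    split : z * x + z * (y - x) ≈ z * y
    split = trans (sym (distribˡ z x (y - x))) (*-congˡ (x+[y-x]≈y x y))

  -- The order need not be decidable, but `≤` is the negation of the reverse strict order, and that
  -- one is preserved by multiplication.
  *-cancelˡ-≤ : ∀ {z x y} → 0# < z → z * x ≤ z * y → x ≤ y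
  *-cancelˡ-≤ 0<z zx≤zy = Equivalence.from ≤⇔≯ λ y<x →
    Equivalence.to ≤⇔≯ zx≤zy (*-monoʳ-< 0<z y<x)

  fromℕ-+ : ∀ m n → fromℕ (m ℕ.+ n) ≈ fromℕ m + fromℕ n
  fromℕ-+ = ×-homo-+ +-monoid 1#

  fromℕ-* : ∀ m n → fromℕ (m ℕ.* n) ≈ fromℕ m * fromℕ n
  fromℕ-* = ×1-homo-* semiring

  fromℕ-nonNegative : ∀ n → 0# ≤ fromℕ n
  fromℕ-nonNegative zero    = ≤-refl
  fromℕ-nonNegative (suc n) = +-nonNegative 0≤1 (fromℕ-nonNegative n)

  fromℕ-mono : ∀ {m n} → m ℕ.≤ n → fromℕ m ≤ fromℕ n
  fromℕ-mono {n = n} z≤n = fromℕ-nonNegative n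
  fromℕ-mono (s≤s m≤n) = +-monoʳ-≤ 1# (fromℕ-mono m≤n)

  fromℕ-positive : ∀ n → 0# < fromℕ (suc n)
  fromℕ-positive zero    = IsStrictPartialOrder.<-respʳ-≈ <-isStrictPartialOrder (sym (+-identityʳ 1#)) 0<1
  fromℕ-positive (suc n) = IsStrictPartialOrder.trans <-isStrictPartialOrder (fromℕ-positive n)
    (IsStrictPartialOrder.<-respˡ-≈ <-isStrictPartialOrder (+-identityˡ _) (+-monoˡ-< _ 0<1))

  -- Then n bounds the geometric series 1 + 2 p + (2 p)² + ⋯, which arises as
  -- passes double in length and fail with probability at most p each.
  GeometricBound : Carrier → ℕ → Set ℓ₂
  GeometricBound p n = 1# + p * fromℕ (2 ℕ.* n) ≤ fromℕ n

  -- Any natural number above the inverse of `1 - 2 p` serves, and the Archimedean axiom provides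
  -- one.
  geometric : ∀ {p} → fromℕ 2 * p < 1# → ∃[ n ] GeometricBound p n
  geometric {p} 2p<1 = n , (begin
    1# + p * fromℕ (2 ℕ.* n)                     ≈⟨ +-congˡ (*-congˡ (fromℕ-* 2 n)) ⟩
    1# + p * (fromℕ 2 * fromℕ n)                 ≤⟨ +-monoˡ-≤ _ 1≤xn ⟩
    x * fromℕ n + p * (fromℕ 2 * fromℕ n)
      ≈⟨ solve 4 (λ x p t n → x :* n :+ p :* (t :* n) := (t :* p :+ x) :* n) ≈-refl x p (fromℕ 2) (fromℕ n) ⟩
    (fromℕ 2 * p + x) * fromℕ n                  ≈⟨ *-congʳ (x+[y-x]≈y (fromℕ 2 * p) 1#) ⟩
    1# * fromℕ n                                 ≈⟨ *-identityˡ (fromℕ n) ⟩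
    fromℕ n                                      ∎)
    where
    x = 1# - fromℕ 2 * p
    0<x : 0# < x
    0<x = IsStrictPartialOrder.<-respˡ-≈ <-isStrictPartialOrder (-‿inverseʳ (fromℕ 2 * p))
            (+-monoˡ-< (- (fromℕ 2 * p)) 2p<1)
    inverse = Equivalence.to #0⇔invertible (inj₂ 0<x)
    bound = archimedean (proj₁ inverse)
    n = proj₁ bound
    1≤xn : 1# ≤ x * fromℕ n
    1≤xn = ≤-trans (≤-reflexive (sym (proj₂ inverse))) (*-monoʳ-≤ (<⇒≤ 0<x) (<⇒≤ (proj₂ bound)))

-- Expected cost of the passes.

module ExpectedCost
  {c ℓ₁ ℓ₂ ℓ₃} (K : ArchimedeanOrderedField c ℓ₁ ℓ₂ ℓ₃)
  (p : ArchimedeanOrderedField.Carrier K)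
  (p-error : OneSidedFalseNegative.IsErrorProbability K p)
  (n : ℕ) (growth : OrderedFieldProperties.GeometricBound K p n)
  {G : Graph} (R : SpanningSubgraph G) (connected : Connected G R)
  where

  open ArchimedeanOrderedField K renaming (refl to ≈-refl)
  open OneSidedFalseNegative K p
  open OrderedFieldProperties K
  open NaturalCoefficients commutativeSemiring using (solve; _:=_; _:+_; _:*_; con)
  open PartialOrderReasoning poset
  open Contraction G
  open Borůvka G
  open Correctness R connected

  private
    0≤p : 0# ≤ p
    0≤p = proj₁ p-error

    p≤1 : p ≤ 1#
    p≤1 = begin
      p                    ≈⟨ *-identityˡ p ⟨
      1# * p               ≈⟨ *-congʳ (+-identityʳ 1#) ⟨
      fromℕ 1 * p          ≤⟨ *-monoˡ-≤ 0≤p (fromℕ-mono {1} {2} (s≤s z≤n)) ⟩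
      fromℕ 2 * p          ≤⟨ <⇒≤ (proj₂ p-error) ⟩
      1#                   ∎

    q : Carrier
    q = 1# - p

    0≤q : 0# ≤ q
    0≤q = -‿nonNegative p≤1

    p+q≈1 : p + q ≈ 1#
    p+q≈1 = x+[y-x]≈y p 1#

  occurs-invariant : ∀ {h} → Occurs R algorithm h → Invariant (state h)
  occurs-invariant start = pass-invariant spans-initial (s≤s z≤n)
  occurs-invariant (next {e = e} {a} o eq possible) =
    answered-invariant {a = a} (occurs-invariant o) eq λ { refl → hit possible }
    where
    hit : Pr {G} R e Yes ≉ 0# → e Subset.∈ R
    hit ≉0 with Vec.lookup R e in e≡
    ... | true  = lookup⇒[]= e R e≡
    -- For an edge that is not realized, Yes has probability `0#`.
    ... | false = contradiction ≈-refl ≉0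

  finds-realized-spanning-tree : FindsRealizedSpanningTree R algorithm
  finds-realized-spanning-tree o = output-correct (occurs-invariant o)

  -- The expected number of queries among the next `N`, by recursion on states instead of histories.
  cost : ℕ → State → Carrier
  cost zero    _                    = 0#
  cost (suc N) ⟨ _ , _ , _ , [] ⟩   = 0#
  cost (suc N) s@(⟨ _ , _ , _ , e ∷ _ ⟩) =
    1# + (Pr {G} R e Yes * cost N (answered s e Yes) + Pr {G} R e No * cost N (answered s e No))

  cost-stopped : ∀ N {L T b} → cost N ⟨ L , T , b , [] ⟩ ≈ 0#
  cost-stopped zero    = ≈-refl
  cost-stopped (suc _) = ≈-refl

  private
    𝔼-query : ∀ (A : Algorithm G) N f h {e} → A h ≡ query e →
              𝔼 R A (suc N) f h ≡ Pr {G} R e Yes * 𝔼 R A N f ((e , Yes) ∷ h)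
                                + Pr {G} R e No  * 𝔼 R A N f ((e , No)  ∷ h)
    𝔼-query A N f h eq with A h | eq
    ... | query _ | refl = refl

    𝔼-output : ∀ (A : Algorithm G) N f h {T} → A h ≡ output T → 𝔼 R A (suc N) f h ≡ f h
    𝔼-output A N f h eq with A h | eq
    ... | output _ | refl = refl

    Pr-total : ∀ e → Pr {G} R e Yes + Pr {G} R e No ≈ 1#
    Pr-total e with Vec.lookup R e
    ... | true  = trans (+-comm q p) p+q≈1
    ... | false = +-identityˡ 1#

  -- The future depends on the history only through the state, and both probabilities add up to 1,
  -- so the queries already made come out of the mean.
  𝔼-cost : ∀ N h → 𝔼 R algorithm N (fromℕ ∘ length) h ≈ fromℕ (length h) + cost N (state h)
  𝔼-cost zero    h = sym (+-identityʳ _)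
  𝔼-cost (suc N) h = unfold (state h) refl
    where
    l = fromℕ (length h)
    unfold : ∀ s → state h ≡ s →
             𝔼 R algorithm (suc N) (fromℕ ∘ length) h ≈ l + cost (suc N) s
    unfold ⟨ _ , T , _ , [] ⟩ eq = trans
      (reflexive (𝔼-output algorithm N (fromℕ ∘ length) h (≡.cong action eq))) (sym (+-identityʳ l))
    unfold s@(⟨ _ , _ , _ , e ∷ _ ⟩) eq = begin-equality
      𝔼 R algorithm (suc N) (fromℕ ∘ length) h
        ≡⟨ 𝔼-query algorithm N (fromℕ ∘ length) h (≡.cong action eq) ⟩
      y * 𝔼 R algorithm N (fromℕ ∘ length) ((e , Yes) ∷ h) + x * 𝔼 R algorithm N (fromℕ ∘ length) ((e , No) ∷ h)
        ≈⟨ +-cong (*-congˡ (𝔼-cost N ((e , Yes) ∷ h))) (*-congˡ (𝔼-cost N ((e , No) ∷ h))) ⟩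
      y * ((1# + l) + cost N (answered (state h) e Yes)) + x * ((1# + l) + cost N (answered (state h) e No))
        ≡⟨ ≡.cong (λ s → y * ((1# + l) + cost N (answered s e Yes)) + x * ((1# + l) + cost N (answered s e No))) eq ⟩
      y * ((1# + l) + cY) + x * ((1# + l) + cN)
        ≈⟨ solve 5 (λ y n k a b → y :* (k :+ a) :+ n :* (k :+ b) := (y :+ n) :* k :+ (y :* a :+ n :* b)) ≈-refl y x (1# + l) cY cN ⟩
      (y + x) * (1# + l) + (y * cY + x * cN)
        ≈⟨ +-congʳ (trans (*-congʳ (Pr-total e)) (*-identityˡ _)) ⟩
      (1# + l) + (y * cY + x * cN)
        ≈⟨ +-congʳ (+-comm 1# l) ⟩
      (l + 1#) + (y * cY + x * cN)
        ≈⟨ +-assoc l 1# _ ⟩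
      l + cost (suc N) s ∎
      where
      y  = Pr {G} R e Yes
      x  = Pr {G} R e No
      cY = cost N (answered s e Yes)
      cN = cost N (answered s e No)

  -- The constant suits the last pass with `b < a` in `fruitless`: `b` for the pass, `n * (2 * b)`
  -- for the later ones, and `b` for the amount subtracted.
  C : ℕ
  C = 2 ℕ.* suc n

  hits : List (Edge G) → Bool
  hits []       = false
  hits (e ∷ es) = Vec.lookup R e ∨ hits es

  -- An upper bound for the probability that every query of the list is answered No; one realized
  -- edge already gives the factor `p`.
  survival : List (Edge G) → Carrier
  survival es = if hits es then p else 1#

  0≤survival : ∀ es → 0# ≤ survival es
  0≤survival es with hits es
  ... | true  = 0≤p
  ... | false = 0≤1

  survival≤1 : ∀ es → survival es ≤ 1#
  survival≤1 es with hits es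
  ... | true  = p≤1
  ... | false = ≤-refl

  firstHit≤⇒hits : ∀ {e es} b → e ∈ es → Vec.lookup R e ≡ true → firstHit R es ℕ.≤ b →
                   hits (take b es) ≡ true
  firstHit≤⇒hits {es = e ∷ es} zero _ _ first with Vec.lookup R e
  firstHit≤⇒hits {es = e ∷ es} zero _ _ () | true
  firstHit≤⇒hits {es = e ∷ es} zero _ _ () | false
  firstHit≤⇒hits {es = e ∷ es} (suc b) (here refl) hit first rewrite hit = refl
  firstHit≤⇒hits {es = e ∷ es} (suc b) (there e∈) hit first with Vec.lookup R e
  ... | true  = refl
  ... | false = firstHit≤⇒hits b e∈ hit (ℕ.s≤s⁻¹ first)

  -- Bounds the expected length of all passes from budget b on, when the first
  -- realized edge is at position a: without a success until 2 ^ i reaches a,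
  -- geometrically afterwards.
  passes : ℕ → ℕ → ℕ
  passes a b with a Nat.≤? b
  ... | yes _ = n ℕ.* b
  ... | no  _ = C ℕ.* a ℕ.∸ b

  passes-≤ : ∀ {a b} → a ℕ.≤ b → passes a b ≡ n ℕ.* b
  passes-≤ {a} {b} a≤b with a Nat.≤? b
  ... | yes _  = refl
  ... | no a≰b = contradiction a≤b a≰b

  passes-start : ∀ {a} → 0 ℕ.< a → passes a 1 ℕ.≤ C ℕ.* a
  passes-start {a} 0<a with a Nat.≤? 1
  ... | yes _ = Nat.*-mono-≤ {n} {C} {1} {a} (Nat.≤-trans (Nat.n≤1+n n) (Nat.m≤m+n (suc n) _)) 0<a
  ... | no  _ = Nat.m∸n≤m (C ℕ.* a) 1

  private
    open Nat-Solver renaming (solve to Nat-solve; _:+_ to _⊕_; _:*_ to _⊗_; _:=_ to _⊜_; con to κ)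

    -- If `2 * b` is still short of `a`, the pass is paid by the growth of the subtracted term from
    -- `b` to `2 * b`; otherwise `b < a` and the choice of `C` suffice.
    fruitless : ∀ a b → ¬ (a ℕ.≤ b) → b ℕ.+ passes a (2 ℕ.* b) ℕ.≤ C ℕ.* a ℕ.∸ b
    fruitless a b a≰b with a Nat.≤? 2 ℕ.* b
    ... | yes _ = Nat.m+n≤o⇒m≤o∸n _ (Nat.≤-trans
        (Nat.≤-reflexive (Nat-solve 2 (λ n b → (b ⊕ n ⊗ (κ 2 ⊗ b)) ⊕ b ⊜ (κ 2 ⊗ (κ 1 ⊕ n)) ⊗ b) refl n b))
        (Nat.*-monoʳ-≤ C (Nat.<⇒≤ (Nat.≰⇒> a≰b))))
    ... | no a≰2b = Nat.m+n≤o⇒m≤o∸n _ (Nat.≤-reflexive (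
        ≡.trans (Nat-solve 2 (λ b x → (b ⊕ x) ⊕ b ⊜ x ⊕ κ 2 ⊗ b) refl b (C ℕ.* a ℕ.∸ 2 ℕ.* b))
        (Nat.m∸n+n≡m (Nat.≤-trans (Nat.<⇒≤ (Nat.≰⇒> a≰2b)) (Nat.m≤m+n a _)))))

  -- Before position `a` is reached, survival is bounded by 1 and `fruitless` applies. Afterwards
  -- the pass contains a realized edge, survival is `p`, and `growth` is scaled by `b`.
  passes-step : ∀ {e es} b → e ∈ es → Vec.lookup R e ≡ true →
                fromℕ b + survival (take b es) * fromℕ (passes (firstHit R es) (2 ℕ.* b))
                  ≤ fromℕ (passes (firstHit R es) b)
  passes-step {es = es} b e∈ hit with firstHit R es Nat.≤? b
  ... | no a≰b = begin
      fromℕ b + survival (take b es) * fromℕ (passes a (2 ℕ.* b))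
        ≤⟨ +-monoʳ-≤ (fromℕ b) (*-monoˡ-≤ (fromℕ-nonNegative (passes a (2 ℕ.* b))) (survival≤1 (take b es))) ⟩
      fromℕ b + 1# * fromℕ (passes a (2 ℕ.* b))
        ≈⟨ +-congˡ (*-identityˡ _) ⟩
      fromℕ b + fromℕ (passes a (2 ℕ.* b))
        ≈⟨ fromℕ-+ b _ ⟨
      fromℕ (b ℕ.+ passes a (2 ℕ.* b))
        ≤⟨ fromℕ-mono (fruitless a b a≰b) ⟩
      fromℕ (C ℕ.* a ℕ.∸ b) ∎
    where a = firstHit R es
  ... | yes a≤b
    rewrite firstHit≤⇒hits b e∈ hit a≤b
          | passes-≤ (Nat.≤-trans a≤b (Nat.m≤m+n b (1 ℕ.* b))) = begin
      fromℕ b + p * fromℕ (n ℕ.* (2 ℕ.* b))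
        ≡⟨ ≡.cong (λ m → fromℕ b + p * fromℕ m) (Nat-solve 2 (λ n b → n ⊗ (κ 2 ⊗ b) ⊜ (κ 2 ⊗ n) ⊗ b) refl n b) ⟩
      fromℕ b + p * fromℕ (2 ℕ.* n ℕ.* b)
        ≈⟨ +-congˡ (*-congˡ (fromℕ-* (2 ℕ.* n) b)) ⟩
      fromℕ b + p * (fromℕ (2 ℕ.* n) * fromℕ b)
        ≈⟨ solve 3 (λ b p m → b :+ p :* (m :* b) := (con 1 :+ p :* m) :* b) ≈-refl (fromℕ b) p (fromℕ (2 ℕ.* n)) ⟩
      (1# + p * fromℕ (2 ℕ.* n)) * fromℕ b
        ≤⟨ *-monoˡ-≤ (fromℕ-nonNegative b) growth ⟩
      fromℕ n * fromℕ b
        ≈⟨ fromℕ-* n b ⟨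
      fromℕ (n ℕ.* b) ∎

  crosses⇒2≤ : ∀ (L : Labelling G) {e} → Crosses L e → 2 ℕ.≤ proj₁ L
  crosses⇒2≤ (zero , φ) {e} _ with φ (src G e)
  ... | ()
  crosses⇒2≤ (suc zero , φ) {e} cross with φ (src G e) | φ (tgt G e)
  ... | zero | zero = contradiction refl cross
  crosses⇒2≤ (suc (suc _) , _) _ = s≤s (s≤s z≤n)

  private
    -- The head of the pending edges is realized: `l` and `w` are length and survival of its tail,
    -- `M` bounds the later passes, `Λ` the cost after a success. As `p` is at most 1, the tail is
    -- charged in full.
    hit-step : ∀ {l w M Λ x y} → 0# ≤ l → 0# ≤ M → w ≤ 1# → x ≤ Λ → y ≤ (l + w * M) + Λ →
               1# + (q * x + p * y) ≤ ((1# + l) + p * M) + Λ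
    hit-step {l} {w} {M} {Λ} {x} {y} 0≤l 0≤M w≤1 x≤ y≤ = begin
      1# + (q * x + p * y)
        ≤⟨ +-monoʳ-≤ 1# (+-mono-≤ (*-monoʳ-≤ 0≤q x≤) (*-monoʳ-≤ 0≤p y≤)) ⟩
      1# + (q * Λ + p * ((l + w * M) + Λ))
        ≤⟨ +-monoʳ-≤ 1# (+-monoʳ-≤ _ (*-monoʳ-≤ 0≤p (+-monoˡ-≤ Λ (+-monoʳ-≤ l (*-monoˡ-≤ 0≤M w≤1))))) ⟩
      1# + (q * Λ + p * ((l + 1# * M) + Λ))
        ≈⟨ solve 5 (λ p q l M Λ → con 1 :+ (q :* Λ :+ p :* ((l :+ con 1 :* M) :+ Λ))
                                := (con 1 :+ p :* l :+ p :* M) :+ (p :+ q) :* Λ) ≈-refl p q l M Λ ⟩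
      (1# + p * l + p * M) + (p + q) * Λ
        ≤⟨ +-mono-≤ (+-monoˡ-≤ _ (+-monoʳ-≤ 1# (≤-trans (*-monoˡ-≤ 0≤l p≤1) (≤-reflexive (*-identityˡ l)))))
                    (≤-reflexive (trans (*-congʳ p+q≈1) (*-identityˡ Λ))) ⟩
      ((1# + l) + p * M) + Λ ∎

    miss-step : ∀ {l w M Λ x y} → y ≤ (l + w * M) + Λ →
                1# + (0# * x + 1# * y) ≤ ((1# + l) + w * M) + Λ
    miss-step {l} {w} {M} {Λ} {x} {y} y≤ = begin
      1# + (0# * x + 1# * y)    ≈⟨ +-congˡ (trans (+-cong (zeroˡ x) (*-identityˡ y)) (+-identityˡ y)) ⟩
      1# + y                    ≤⟨ +-monoʳ-≤ 1# y≤ ⟩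
      1# + ((l + w * M) + Λ)
        ≈⟨ solve 4 (λ k l m Λ → k :+ ((l :+ m) :+ Λ) := ((k :+ l) :+ m) :+ Λ) ≈-refl 1# l (w * M) Λ ⟩
      ((1# + l) + w * M) + Λ    ∎

    firstHit>0 : ∀ {e es} → e ∈ es → 0 ℕ.< firstHit R es
    firstHit>0 {es = e ∷ _} _ with Vec.lookup R e
    ... | true  = s≤s z≤n
    ... | false = s≤s z≤n

  -- Amortisation against a potential.

  -- rem is a budget of queries, up to the factor C: finding any edge of the
  -- star lowers it by at least the position of the first realized one.
  module Budget {ℓ}
    (Good : Labelling G → Set ℓ) (rem : Labelling G → Carrier)
    (good-onto     : ∀ {L} → Good L → Onto L)
    (good-contract : ∀ {L e} → Good L → e ∈ star L → Good (contract L e))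
    (rem≥0         : ∀ {L} → Good L → 0# ≤ rem L)
    (rem-drop      : ∀ {L e} → Good L → e ∈ star L → Vec.lookup R e ≡ true →
                     rem (contract L e) + fromℕ (delay R L) ≤ rem L)
    where

    private
      -- What is left once the star has been paid for; it covers the whole cost after any
      -- contraction of a realized edge of the star.
      rest : Labelling G → Carrier
      rest L = fromℕ C * (rem L - fromℕ (delay R L))

      rest+delay : ∀ L → fromℕ (C ℕ.* delay R L) + rest L ≈ fromℕ C * rem L
      rest+delay L = begin-equality
        fromℕ (C ℕ.* a) + fromℕ C * (rem L - fromℕ a)       ≈⟨ +-congʳ (fromℕ-* C a) ⟩
        fromℕ C * fromℕ a + fromℕ C * (rem L - fromℕ a)     ≈⟨ distribˡ (fromℕ C) _ _ ⟨
        fromℕ C * (fromℕ a + (rem L - fromℕ a))             ≈⟨ *-congˡ (x+[y-x]≈y (fromℕ a) (rem L)) ⟩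
        fromℕ C * rem L                                     ∎
        where a = delay R L

      contract≤rest : ∀ {L e} → Good L → e ∈ star L → Vec.lookup R e ≡ true →
                      fromℕ C * rem (contract L e) ≤ rest L
      contract≤rest {L} {e} good e∈ hit = *-monoʳ-≤ (fromℕ-nonNegative C) (begin
        r                      ≈⟨ +-identityʳ r ⟨
        r + 0#                 ≈⟨ +-congˡ (-‿inverseʳ a) ⟨
        r + (a - a)            ≈⟨ +-assoc r a (- a) ⟨
        (r + a) - a            ≤⟨ +-monoˡ-≤ (- a) (rem-drop good e∈ hit) ⟩
        rem L - a              ∎)
        where
        r = rem (contract L e)
        a = fromℕ (delay R L)

      Hit : Labelling G → Set
      Hit L = ∃[ e ] e ∈ star L × Vec.lookup R e ≡ true

      rest≥0 : ∀ {L} → Good L → Hit L → 0# ≤ rest L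
      rest≥0 {L} good (e , e∈ , hit) = ≤-trans
        (*-nonNegative (fromℕ-nonNegative C) (rem≥0 (good-contract good e∈)))
        (contract≤rest good e∈ hit)

      -- The pending queries, then the later passes weighted by a bound on the chance of reaching
      -- them, then the cost after a success.
      future : Labelling G → ℕ → List (Edge G) → Carrier
      future L b es = (fromℕ (length es) + survival es * fromℕ (passes (delay R L) (2 ℕ.* b))) + rest L

      future≥0 : ∀ {L} b es → Good L → Hit L → 0# ≤ future L b es
      future≥0 {L} b es good hit = +-nonNegative
        (+-nonNegative (fromℕ-nonNegative (length es))
          (*-nonNegative (0≤survival es) (fromℕ-nonNegative (passes (delay R L) (2 ℕ.* b)))))
        (rest≥0 good hit)

    -- The four bounds form one induction on `N`, which drops at each query in `pending-bound`; the
    -- others unfold how a pass begins or goes on.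
    pass-bound    : ∀ N {L} T → Good L → cost N (pass L T 1) ≤ fromℕ C * rem L
    retry-bound   : ∀ N {L} T b → Good L → Hit L →
                    cost N (pass L T b) ≤ fromℕ (passes (delay R L) b) + rest L
    resume-bound  : ∀ N {L} T b es → Good L → Hit L → es ⊆ star L →
                    cost N (resume L T b es) ≤ future L b es
    pending-bound : ∀ N {L} T b e es → Good L → Hit L → e ∷ es ⊆ star L →
                    cost N ⟨ L , T , b , e ∷ es ⟩ ≤ future L b (e ∷ es)

    pass-bound N {L} T good with star L in eq
    pass-bound N {L} T good | e ∷ es = begin
      cost N ⟨ L , T , 1 , e ∷ [] ⟩              ≡⟨ ≡.cong (λ es → cost N ⟨ L , T , 1 , take 1 es ⟩) eq ⟨
      cost N (pass L T 1)                        ≤⟨ retry-bound N T 1 good hit ⟩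
      fromℕ (passes (delay R L) 1) + rest L
        ≤⟨ +-monoˡ-≤ (rest L) (fromℕ-mono (passes-start (firstHit>0 e∈))) ⟩
      fromℕ (C ℕ.* delay R L) + rest L           ≈⟨ rest+delay L ⟩
      fromℕ C * rem L                            ∎
      where
      e∈ : e ∈ star L
      e∈ = subst (e ∈_) (≡.sym eq) (here refl)
      -- A nonempty star means two labels at least, so connectedness supplies a realized edge in it.
      hit : Hit L
      hit with star-hit R L (good-onto good) (crosses⇒2≤ L (star-crosses L e∈)) connected
      ... | f , f∈ , f∈R = f , f∈ , []=⇒lookup f∈R
    pass-bound N {L} T good | [] = ≤-trans (≤-reflexive (cost-stopped N))
      (*-nonNegative (fromℕ-nonNegative C) (rem≥0 good))

    retry-bound N {L} T b good hit@(e , e∈ , e-hit) = ≤-trans first-pass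
      (+-monoˡ-≤ (rest L) (≤-trans (+-monoˡ-≤ _ (fromℕ-mono length≤)) (passes-step b e∈ e-hit)))
      where
      length≤ : length (take b (star L)) ℕ.≤ b
      length≤ = Nat.≤-trans (Nat.≤-reflexive (length-take b (star L))) (Nat.m⊓n≤m b _)
      first-pass : cost N (pass L T b) ≤ future L b (take b (star L))
      first-pass with take b (star L) | take-⊆ b (star L)
      first-pass | e ∷ es | within = pending-bound N T b e es good hit within
      first-pass | []     | _ = ≤-trans (≤-reflexive (cost-stopped N)) (future≥0 b [] good hit)

    resume-bound N {L} T b []       good hit _ = ≤-trans (retry-bound N T (2 ℕ.* b) good hit)
      (+-monoˡ-≤ (rest L) (≤-reflexive (sym (trans (+-identityˡ _) (*-identityˡ _)))))
    resume-bound N {L} T b (e ∷ es) good hit within = pending-bound N T b e es good hit within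

    pending-bound zero    T b e es good hit _ = future≥0 b (e ∷ es) good hit
    pending-bound (suc N) {L} T b e es good hit within with Vec.lookup R e in eq
    -- A Yes starts afresh on the contracted labelling, paid from `rest`; a No goes on with the
    -- tail.
    ... | true  = hit-step (fromℕ-nonNegative (length es)) (fromℕ-nonNegative (passes (delay R L) (2 ℕ.* b))) (survival≤1 es)
      (≤-trans (pass-bound N _ (good-contract good e∈)) (contract≤rest good e∈ eq))
      (resume-bound N T b es good hit (within ∘ there))
      where
      e∈ : e ∈ star L
      e∈ = within (here refl)
    ... | false = miss-step (resume-bound N T b es good hit (within ∘ there))

    expected-queries : Good initial → ∀ {B} → fromℕ C * rem initial ≤ B → ExpectedQueries≤ R algorithm B
    expected-queries good ≤B N = begin
      𝔼 R algorithm N (fromℕ ∘ length) []           ≈⟨ 𝔼-cost N [] ⟩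
      0# + cost N (pass initial Subset.⊥ 1)         ≈⟨ +-identityˡ _ ⟩
      cost N (pass initial Subset.⊥ 1)              ≤⟨ pass-bound N Subset.⊥ good ⟩
      fromℕ C * rem initial                         ≤⟨ ≤B ⟩
      _                                             ∎

-- The two query bounds.

module QueryBounds
  {c ℓ₁ ℓ₂ ℓ₃} (K : ArchimedeanOrderedField c ℓ₁ ℓ₂ ℓ₃)
  (p : ArchimedeanOrderedField.Carrier K)
  (p-error : OneSidedFalseNegative.IsErrorProbability K p)
  (n : ℕ) (growth : OrderedFieldProperties.GeometricBound K p n)
  {G : Graph} (R : SpanningSubgraph G) (connected : Connected G R)
  where

  open ArchimedeanOrderedField K hiding (zero) renaming (refl to ≈-refl)
  open OneSidedFalseNegative K p
  open OrderedFieldProperties K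
  open ExpectedCost K p p-error n growth R connected
  open NaturalCoefficients commutativeSemiring using (solve; _:=_; _:+_; _:*_)
  open PartialOrderReasoning poset
  open Contraction G
  open Borůvka G

  -- The potential is the harmonic sum up to the number of labels: with `k` labels the delay is at
  -- most `M / k`, the term lost on passing to `k - 1`.
  uses-O[m*logn] : Uses-O[m*logn] (C ℕ.* 4) R algorithm
  uses-O[m*logn] = Budget.expected-queries Onto (λ L → fromℕ (harmonic M (proj₁ L)))
    id (λ {L} {e} onto e∈ → contract-onto L e (star-crosses L e∈) onto)
    (λ {L} _ → fromℕ-nonNegative (harmonic M (proj₁ L))) drop (λ x → x , refl) (begin
      fromℕ C * fromℕ (harmonic M (∣V∣ G))          ≈⟨ fromℕ-* C (harmonic M (∣V∣ G)) ⟨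
      fromℕ (C ℕ.* harmonic M (∣V∣ G))
        ≤⟨ fromℕ-mono (Nat.*-monoʳ-≤ C (harmonic-log M (∣V∣ G))) ⟩
      fromℕ (C ℕ.* (M ℕ.* ⌊log₂ ∣V∣ G ⌋))           ≡⟨ ≡.cong fromℕ regroup ⟩
      fromℕ (C ℕ.* 4 ℕ.* (∣E∣ G ℕ.* ⌊log₂ ∣V∣ G ⌋)) ∎)
    where
    M = 4 ℕ.* ∣E∣ G
    regroup : C ℕ.* (M ℕ.* ⌊log₂ ∣V∣ G ⌋) ≡ C ℕ.* 4 ℕ.* (∣E∣ G ℕ.* ⌊log₂ ∣V∣ G ⌋)
    regroup = ≡.trans (≡.cong (C ℕ.*_) (Nat.*-assoc 4 (∣E∣ G) _)) (≡.sym (Nat.*-assoc C 4 (∣E∣ G ℕ.* ⌊log₂ ∣V∣ G ⌋)))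
    harmonic-pred : ∀ k a → 2 ℕ.≤ k → k ℕ.* a ℕ.≤ M → harmonic M (pred k) ℕ.+ a ℕ.≤ harmonic M k
    harmonic-pred (suc zero) a (s≤s ())
    harmonic-pred (suc (suc k)) a _ ka≤M = Nat.+-monoʳ-≤ (harmonic M (suc k))
      (Nat.≤-trans
      (Nat.≤-reflexive (≡.trans (≡.sym (m*n/n≡m a (2 ℕ.+ k))) (≡.cong (_/ (2 ℕ.+ k)) (Nat.*-comm a (2 ℕ.+ k)))))
      (/-monoˡ-≤ (2 ℕ.+ k) ka≤M))
    drop : ∀ {L e} → Onto L → e ∈ star L → Vec.lookup R e ≡ true →
           fromℕ (harmonic M (proj₁ (contract L e))) + fromℕ (delay R L) ≤ fromℕ (harmonic M (proj₁ L))
    drop {L} {e} _ e∈ _ rewrite contract-size L e (star-crosses L e∈) = ≤-trans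
      (≤-reflexive (sym (fromℕ-+ (harmonic M (pred (proj₁ L))) (delay R L))))
      (fromℕ-mono (harmonic-pred (proj₁ L) (delay R L) (crosses⇒2≤ L (star-crosses L e∈)) (delay-load R L e∈)))

  module _ {ℓ} {ρ : Carrier} {𝓕 : Pred Graph ℓ} where

    data MinorOf𝓕 : Labelling G → Set ℓ where
      minor : ∀ {H} (φ : Vertex G → Vertex H) → 𝓕 H → Represents H φ → MinorOf𝓕 (∣V∣ H , φ)

    minor-contract : MinorClosed 𝓕 → ∀ {L e} → Crosses L e → MinorOf𝓕 L → MinorOf𝓕 (contract L e)
    minor-contract closed {e = e} cross (minor {H} φ H∈𝓕 represents) =
      contract-elim MinorOf𝓕 (∣V∣ H , φ) e cross λ cross′ →
        minor (merge cross′ ∘ φ) (closed (contraction-step φ represents cross′ ◅ ε) H∈𝓕) (Adjacent⇔Linked _ _)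

    -- Sparsity of the contracted graph bounds its average degree by `2 ρ`, and `d` is at most twice
    -- the average.
    degree≤ : (∀ {H} → 𝓕 H → Sparse ρ H) → ∀ {L d} → MinorOf𝓕 L → 0 ℕ.< proj₁ L →
              proj₁ L ℕ.* d ℕ.≤ 2 ℕ.* ∑ (Quotient.degree L) → fromℕ d ≤ fromℕ 4 * ρ
    degree≤ sparse {d = d} (minor {H} φ H∈𝓕 represents) 0<k kd≤ = *-cancelˡ-≤ (positive 0<k) (begin
      fromℕ k * fromℕ d                     ≈⟨ fromℕ-* k d ⟨
      fromℕ (k ℕ.* d)                       ≤⟨ fromℕ-mono (Nat.≤-trans kd≤ (Nat.*-monoʳ-≤ 2 ∑degree≤)) ⟩
      fromℕ (2 ℕ.* (2 ℕ.* ∣E∣ H))           ≡⟨ ≡.cong fromℕ (Nat.*-assoc 2 2 (∣E∣ H)) ⟨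
      fromℕ (4 ℕ.* ∣E∣ H)                   ≈⟨ fromℕ-* 4 (∣E∣ H) ⟩
      fromℕ 4 * fromℕ (∣E∣ H)               ≤⟨ *-monoʳ-≤ (fromℕ-nonNegative 4) (sparse H∈𝓕) ⟩
      fromℕ 4 * (ρ * fromℕ k)
        ≈⟨ solve 3 (λ f r k → f :* (r :* k) := k :* (f :* r)) ≈-refl (fromℕ 4) ρ (fromℕ k) ⟩
      fromℕ k * (fromℕ 4 * ρ)               ∎)
      where
      k = ∣V∣ H
      positive : ∀ {k} → 0 ℕ.< k → 0# < fromℕ k
      positive {suc k} _ = fromℕ-positive k
      ∑degree≤ : ∑ (Quotient.degree (k , φ)) ℕ.≤ 2 ℕ.* ∣E∣ H
      ∑degree≤ = ∑-degree≤ (φ ∘ src G) (φ ∘ tgt G) (src H) (tgt H) (Equivalence.from (represents _ _))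

    -- An end of the edge makes the number of vertices positive, and sparsity can be divided by it.
    ρ≥0 : Sparse ρ G → Edge G → 0# ≤ ρ
    ρ≥0 sparse e = *-cancelˡ-≤ (positive (src G e)) (begin
      fromℕ (∣V∣ G) * 0#   ≈⟨ zeroʳ _ ⟩
      0#                   ≤⟨ fromℕ-nonNegative (∣E∣ G) ⟩
      fromℕ (∣E∣ G)        ≤⟨ sparse ⟩
      ρ * fromℕ (∣V∣ G)    ≈⟨ *-comm ρ _ ⟩
      fromℕ (∣V∣ G) * ρ    ∎)
      where
      positive : ∀ {k} → Fin k → 0# < fromℕ k
      positive {suc k} _ = fromℕ-positive k

    edgeless-or-edge : ∀ m → m ≡ 0 ⊎ Fin m
    edgeless-or-edge zero    = inj₁ refl
    edgeless-or-edge (suc m) = inj₂ zero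

    -- The potential is `4 ρ` times the number of crossing edges, since the factor `d` of
    -- `delay-degree` is at most `4 ρ` in every minor that arises.
    uses-O[ρ*m] : SparseMinorClosed ρ 𝓕 G → Uses-O[ρ*m] (C ℕ.* 4) ρ R algorithm
    uses-O[ρ*m] (closed , sparse , G∈𝓕) with edgeless-or-edge (∣E∣ G)
    -- Without edges the sign of `ρ` may be undetermined, but both bounds vanish and the first one
    -- applies.
    ... | inj₁ m≡0 = λ N → ≤-trans (uses-O[m*logn] N) (begin
      fromℕ (C ℕ.* 4 ℕ.* (∣E∣ G ℕ.* ⌊log₂ ∣V∣ G ⌋))
        ≡⟨ ≡.cong (λ m → fromℕ (C ℕ.* 4 ℕ.* (m ℕ.* ⌊log₂ ∣V∣ G ⌋))) m≡0 ⟩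
      fromℕ (C ℕ.* 4 ℕ.* 0)                          ≡⟨ ≡.cong fromℕ (Nat.*-zeroʳ (C ℕ.* 4)) ⟩
      0#                                             ≈⟨ zeroʳ _ ⟨
      fromℕ (C ℕ.* 4) * 0#                           ≈⟨ *-congˡ (zeroʳ ρ) ⟨
      fromℕ (C ℕ.* 4) * (ρ * 0#)
        ≡⟨ ≡.cong (λ m → fromℕ (C ℕ.* 4) * (ρ * fromℕ m)) m≡0 ⟨
      fromℕ (C ℕ.* 4) * (ρ * fromℕ (∣E∣ G))          ∎)
    ... | inj₂ edge = Budget.expected-queries (λ L → Onto L × MinorOf𝓕 L) (λ L → D * fromℕ (crossings L))
      proj₁
      (λ {L} {e} (onto , m) e∈ → contract-onto L e (star-crosses L e∈) onto , minor-contract closed (star-crosses L e∈) m)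
      (λ {L} _ → *-nonNegative D≥0 (fromℕ-nonNegative (crossings L)))
      drop ((λ x → x , refl) , minor id G∈𝓕 self) (begin
        fromℕ C * (D * fromℕ (crossings initial))
          ≤⟨ *-monoʳ-≤ (fromℕ-nonNegative C) (*-monoʳ-≤ D≥0 (fromℕ-mono crossings≤)) ⟩
        fromℕ C * (fromℕ 4 * ρ * fromℕ (∣E∣ G))
          ≈⟨ solve 4 (λ c f r m → c :* (f :* r :* m) := c :* f :* (r :* m)) ≈-refl (fromℕ C) (fromℕ 4) ρ (fromℕ (∣E∣ G)) ⟩
        fromℕ C * fromℕ 4 * (ρ * fromℕ (∣E∣ G))
          ≈⟨ *-congʳ (fromℕ-* C 4) ⟨
        fromℕ (C ℕ.* 4) * (ρ * fromℕ (∣E∣ G)) ∎)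
      where
      D : Carrier
      D = fromℕ 4 * ρ
      D≥0 : 0# ≤ D
      D≥0 = *-nonNegative (fromℕ-nonNegative 4) (ρ≥0 (sparse G∈𝓕) edge)

      crossings≤ : crossings initial ℕ.≤ ∣E∣ G
      crossings≤ = Nat.≤-trans (∑-mono (λ e → 𝟙≤1 (crosses? initial e)))
        (Nat.≤-reflexive (≡.trans (∑-const (∣E∣ G) 1) (Nat.*-identityʳ (∣E∣ G))))

      self : Represents G id
      self x y = mk⇔ (λ a → distinct a , a) proj₂
        where
        distinct : ∀ {x y} → Adjacent G x y → x ≢ y
        distinct (e , inj₁ (refl , refl)) = Graph.loopless G e
        distinct (e , inj₂ (refl , refl)) = Graph.loopless G e ∘ ≡.sym

      drop : ∀ {L e} → Onto L × MinorOf𝓕 L → e ∈ star L → Vec.lookup R e ≡ true →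
             D * fromℕ (crossings (contract L e)) + fromℕ (delay R L) ≤ D * fromℕ (crossings L)
      drop {L} {e} (_ , m) e∈ hit with delay-degree R L e∈ hit
      ... | d , w , kd≤ , a≤dw , w+c′≤c = begin
        D * fromℕ c′ + fromℕ (delay R L)      ≤⟨ +-monoʳ-≤ _ (fromℕ-mono a≤dw) ⟩
        D * fromℕ c′ + fromℕ (d ℕ.* w)        ≈⟨ +-congˡ (fromℕ-* d w) ⟩
        D * fromℕ c′ + fromℕ d * fromℕ w      ≤⟨ +-monoʳ-≤ _ (*-monoˡ-≤ (fromℕ-nonNegative w) d≤D) ⟩
        D * fromℕ c′ + D * fromℕ w
          ≈⟨ solve 3 (λ D x y → D :* x :+ D :* y := D :* (y :+ x)) ≈-refl D (fromℕ c′) (fromℕ w) ⟩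
        D * (fromℕ w + fromℕ c′)              ≈⟨ *-congˡ (fromℕ-+ w c′) ⟨
        D * fromℕ (w ℕ.+ c′)                  ≤⟨ *-monoʳ-≤ D≥0 (fromℕ-mono w+c′≤c) ⟩
        D * fromℕ (crossings L)               ∎
        where
        c′ = crossings (contract L e)
        d≤D : fromℕ d ≤ D
        d≤D = degree≤ sparse m (Nat.≤-trans (s≤s z≤n) (crosses⇒2≤ L (star-crosses L e∈))) kd≤

open OneSidedFalseNegative
open ArchimedeanOrderedField using (Carrier)

theorem3 : ∀ {c ℓ₁ ℓ₂ ℓ₃ ℓ} (K : ArchimedeanOrderedField c ℓ₁ ℓ₂ ℓ₃)
    (p : Carrier K) → IsErrorProbability K p →
    Σ[ A ∈ ((G : Graph) → Algorithm G) ] Σ[ C ∈ ℕ ]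
    ((G : Graph) →
    ((R : SpanningSubgraph G) → Connected G R →
    FindsRealizedSpanningTree K p R (A G)
    × Uses-O[m*logn] K p C R (A G))
    × ((ρ : Carrier K) (𝓕 : Pred Graph ℓ) → SparseMinorClosed K p ρ 𝓕 G →
    (R : SpanningSubgraph G) → Connected G R →
    Uses-O[ρ*m] K p C ρ R (A G)))
-- The algorithm is the same for all `p`; the constant depends on `p` through `n`, and its factor 4
-- is that of `4 m` and `4 ρ` in the potentials.
theorem3 K p p-error with OrderedFieldProperties.geometric K (proj₂ p-error)
... | n , growth = Borůvka.algorithm , 2 ℕ.* suc n ℕ.* 4 , λ G →
  (λ R connected → ExpectedCost.finds-realized-spanning-tree K p p-error n growth R connected
                 , QueryBounds.uses-O[m*logn] K p p-error n growth R connected) ,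
  (λ ρ 𝓕 sparse R connected → QueryBounds.uses-O[ρ*m] K p p-error n growth R connected sparse)
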